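{- Let $q$ be a prime power, $n=tt'$ with integers $t,t'\ge2$, and $f(x)=\sum_{i=0}^{n-1}a_ix^{q^i}\in\mathbb{F}_{q^n}[x]$. For $\sigma\in\mathbb{F}_{q^n}^*$ let $f_{t,\sigma}\colon\mathbb{F}_{q^t}\to\mathbb{F}_{q^n}$, $x\mapsto f(\sigma x)$. (a) Let $k$ be a non-negative integer. Then $f$ is R-$q^t$-partially scattered if and only if, for every $\sigma\in\mathbb{F}_{q^n}^*$, the code $\mathcal C_{f,\sigma,k}=\{\alpha f_{t,\sigma}(x)+\beta x^{q^{kt}}\colon\alpha,\beta\in\mathbb{F}_{q^n}\}$ of $\mathbb{F}_q$-linear maps $\mathbb{F}_{q^t}\to\mathbb{F}_{q^n}$ is an MRD-code with parameters $(n,t,q;t-1)$. (b) Assume $t=t'=2$ (so $n=4$). A $q$-polynomial $f(x)$ over $\mathbb{F}_{q^4}$ is R-$q^2$-partially scattered if and only if $\mathcal C=\{\alpha f(x)+\beta x+\gamma x^{q^2}\colon\alpha,\beta,\gamma\in\mathbb{F}_{q^4}\}$ is an MRD-code with parameters $(4,4,q;2)$.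
   Context: A $q$-polynomial $f$ over $\mathbb{F}_{q^n}$ is R-$q^t$-partially scattered if for all $y,z\in\mathbb{F}_{q^n}^*$, $f(y)/y=f(z)/z$ and $y/z\in\mathbb{F}_{q^t}$ imply $y/z\in\mathbb{F}_q$. $\mathbb{F}_q$-linear maps $\mathbb{F}_{q^t}\to\mathbb{F}_{q^n}$ are identified with matrices in $\mathbb{F}_q^{n\times t}$ (and endomorphisms of $\mathbb{F}_{q^4}$ with $\mathbb{F}_q^{4\times4}$). An $\mathbb{F}_q$-linear rank metric code $\mathcal C\subseteq\mathbb{F}_q^{\ell\times m}$ with minimum rank distance $d$ satisfies $\dim_{\mathbb{F}_q}\mathcal C\le\max\{\ell,m\}(\min\{\ell,m\}-d+1)$; it is an MRD-code with parameters $(\ell,m,q;d)$ if its minimum distance is $d$ and equality holds. -}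

module Defs where

open import Level using (0ℓ)
open import Data.Nat as ℕ using (ℕ; zero; suc)
open import Data.Nat.Primality using (Prime)
open import Data.Fin using (Fin; toℕ)
open import Data.Product using (Σ; ∃; _×_; _,_; proj₁)
open import Relation.Binary.PropositionalEquality using (_≡_)
open import Relation.Nullary using (¬_)
open import Algebra.Structures using (IsCommutativeRing)

IsPrimePower : ℕ → Set
IsPrimePower q = Σ ℕ λ p → Σ ℕ λ e → Prime p × q ≡ p ℕ.^ suc e

record Field : Set₁ where
  infixl 6 _+_
  infixl 7 _*_
  field
    Carrier : Set
    _+_ _*_ : Carrier → Carrier → Carrier
    -_ : Carrier → Carrier
    0# 1# : Carrier
    _⁻¹ : Carrier → Carrier
    isCommutativeRing : IsCommutativeRing _≡_ _+_ _*_ -_ 0# 1#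
    0≢1 : ¬ (0# ≡ 1#)
    ⁻¹-inverse : ∀ x → ¬ (x ≡ 0#) → x * (x ⁻¹) ≡ 1#

module FF (F : Field) where
  open Field F public

  _^_ : Carrier → ℕ → Carrier
  x ^ zero = 1#
  x ^ suc m = x * (x ^ m)

  sumF : ∀ {m} → (Fin m → Carrier) → Carrier
  sumF {zero} g = 0#
  sumF {suc m} g = g Fin.zero + sumF (λ i → g (Fin.suc i))

  -- membership in the subfield F_{Q}, Q a power of q : x^Q = x
  InSub : ℕ → Carrier → Set
  InSub Q x = x ^ Q ≡ x

  Sub : ℕ → Set
  Sub Q = Σ Carrier (InSub Q)

  qpoly : (q : ℕ) {m : ℕ} → (Fin m → Carrier) → Carrier → Carrier
  qpoly q a x = sumF (λ i → a i * (x ^ (q ℕ.^ toℕ i)))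

  PartiallyScattered : (q t : ℕ) {m : ℕ} → (Fin m → Carrier) → Set
  PartiallyScattered q t a =
    ∀ y z → ¬ (y ≡ 0#) → ¬ (z ≡ 0#) →
      qpoly q a y * (y ⁻¹) ≡ qpoly q a z * (z ⁻¹) →
      InSub (q ℕ.^ t) (y * (z ⁻¹)) → InSub q (y * (z ⁻¹))

  -- F_q-linear algebra in F_q-vector spaces of the form (D → F) with
  -- pointwise operations (F itself is the case of D = a one-point type).
  module Lin (q : ℕ) (D : Set) where
    V : Set
    V = D → Carrier

    _≈_ : V → V → Set
    φ ≈ ψ = ∀ x → φ x ≡ ψ x

    lincomb : ∀ {r} → (Fin r → Sub q) → (Fin r → V) → V
    lincomb c v x = sumF (λ i → proj₁ (c i) * v i x)

    LinIndep : ∀ {r} → (Fin r → V) → Set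
    LinIndep v = ∀ c → lincomb c v ≈ (λ _ → 0#) → ∀ i → proj₁ (c i) ≡ 0#

    Spans : ∀ {r} → (V → Set) → (Fin r → V) → Set
    Spans S v = ∀ φ → S φ → ∃ λ c → φ ≈ lincomb c v

    HasDim : (V → Set) → ℕ → Set
    HasDim S r = Σ (Fin r → V) λ v → (∀ i → S (v i)) × LinIndep v × Spans S v

  module _ (q : ℕ) where
    open import Data.Unit using (⊤; tt)
    HasRank : {D : Set} → (D → Carrier) → ℕ → Set
    HasRank φ r = Lin.HasDim q ⊤ (λ w → ∃ λ x → φ x ≡ w tt) r

    -- C ⊆ (D → F) (an F_q-linear code of maps, identified with ℓ×m
    -- matrices over F_q) is an MRD code with parameters (ℓ,m,q;d)
    IsMRD : {D : Set} → (ℓ m d : ℕ) → (Lin.V q D → Set) → Set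
    IsMRD {D} ℓ m d C =
      ( (∀ φ → C φ → ¬ (∀ x → φ x ≡ 0#) → ∃ λ r → HasRank φ r × d ℕ.≤ r)
      × (∃ λ φ → C φ × ¬ (∀ x → φ x ≡ 0#) × HasRank φ d) )
      × Lin.HasDim q D C (ℕ._⊔_ ℓ m ℕ.* suc (ℕ._⊓_ ℓ m ℕ.∸ d))

    Cfσk : (t : ℕ) {m : ℕ} → (Fin m → Carrier) → Carrier → ℕ →
           Lin.V q (Sub (q ℕ.^ t)) → Set
    Cfσk t a σ k φ = ∃ λ α → ∃ λ β → ∀ (x : Sub (q ℕ.^ t)) →
      φ x ≡ α * qpoly q a (σ * proj₁ x) + β * (proj₁ x ^ (q ℕ.^ (k ℕ.* t)))

    C4 : {m : ℕ} → (Fin m → Carrier) → Lin.V q Carrier → Set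
    C4 a φ = ∃ λ α → ∃ λ β → ∃ λ γ → ∀ x →
      φ x ≡ α * qpoly q a x + β * x + γ * (x ^ (q ℕ.^ 2))

{-# OPTIONS --safe #-}
module Submission where

-- All dimensions and ranks are found by counting: a subspace of dimension r has q^r elements, and a
-- linear map of rank r on d elements whose kernel has b elements satisfies q^r b = d.
--
-- (a) On F_{q^t} the members of the code are x ↦ α f(σx) + β x, and two kernel elements x, y of
-- such a map with α ≠ 0 have f(σx)/σx = f(σy)/σy. So f is scattered iff no nonzero member has two
-- kernel elements with ratio outside F_q; in the converse, σ = z and α f(zx) + β x = f(zx) - f(z) x
-- vanishes at 1 and y/z, and it is not zero because the code would then have dimension at most n.
--
-- (b) For α ≠ 0 and μ in F_{q^2} but not in F_q, a map φ of rank at most 1 has some z ≠ 0 with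
-- φ(z) = φ(μz) = 0, because z ↦ (φ(z), φ(μz)) takes at most q^2 values; then f(z)/z = f(μz)/(μz).
-- In the converse one interpolates f by b x + c x^{q^2} at z and at some point outside F_{q^2} z, and the
-- difference has a kernel of dimension at least 3.

open import Defs
open import Level using (0ℓ)
open import Algebra.Bundles using (CommutativeRing)
open import Data.Empty using (⊥; ⊥-elim)
open import Data.Fin as Fin using (Fin)
open import Data.Fin.Permutation using (Permutation; permutation; _⟨$⟩ʳ_)
import Data.Fin.Properties as Finₚ
open import Data.Nat as ℕ using (ℕ; zero; suc; _≤_; _<_; z≤n; s≤s)
open import Data.Nat.Combinatorics using (_C_; nCn≡1; nC1≡n; nCk≡nC[n∸k]; nCk+nC[k+1]≡[n+1]C[k+1])
open import Data.Nat.Divisibility using (_∣_; divides; m∣m*n; ∣⇒≤)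
open import Data.Nat.Primality using (Prime; euclidsLemma; prime⇒nonTrivial)
import Data.Nat.Properties as ℕₚ
open import Data.Nat.Tactic.RingSolver using (solve-∀)
open import Data.Product using (Σ; ∃; _×_; _,_; proj₁; proj₂)
open import Data.Sum using (_⊎_; inj₁; inj₂; [_,_]′)
open import Data.Unit using (⊤; tt)
open import Data.Vec.Functional using (_∷_)
open import Function.Bundles using (_↔_; _⇔_; Inverse; mk⇔)
open import Relation.Binary.PropositionalEquality
open import Relation.Binary.PropositionalEquality.WithK using (≡-irrelevant)
open import Relation.Nullary using (¬_; Dec; yes; no; contradiction)
open import Relation.Nullary.Decidable using (map′; decidable-stable; ¬?; _×-dec_; toSum)

-- Counting up to an equivalence relation

-- Finiteness enters only as a bijection of the field with a `Fin`. Decidable equality, the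
-- characteristic, x^(q^n) = x, and above all the fact that x^q = x has exactly q solutions are
-- derived from it: a space of dimension r has q^r elements only because there are exactly q
-- scalars. Vectors are functions compared pointwise, so what is counted are classes of an
-- equivalence relation. The numbers compared are powers of q, and an inequality between them passes
-- to the exponents; this takes the place of rank-nullity and of the invariance of dimension. In (b)
-- the maps β x + γ x^(q^2) are linear over F_(q^2), so adding one to α f does not disturb the
-- comparison of f(μz) with μ f(z) for μ in F_(q^2). For the same reason two interpolation
-- conditions yield three independent kernel elements: agreement with f at z carries over to μz.

proj₁-injective : {A : Set} {P : A → Set} → (∀ {a} (p p′ : P a) → p ≡ p′) →
                  {x y : Σ A P} → proj₁ x ≡ proj₁ y → x ≡ y
proj₁-injective irr {a , p} {.a , p′} refl = cong (a ,_) (irr p p′)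

-- The relation is that of having the same index, so it is automatically a decidable equivalence. A
-- general relation allows functions that agree pointwise to count once.
record Size {A : Set} (_~_ : A → A → Set) (n : ℕ) : Set where
  field
    index           : A → Fin n
    elem            : Fin n → A
    index-cong      : ∀ {a b} → a ~ b → index a ≡ index b
    index-injective : ∀ {a b} → index a ≡ index b → a ~ b
    index-elem      : ∀ i → index (elem i) ≡ i

  elem-index : ∀ a → elem (index a) ~ a
  elem-index a = index-injective (index-elem (index a))

  elem-injective : ∀ {i j} → elem i ~ elem j → i ≡ j
  elem-injective {i} {j} e = trans (sym (index-elem i)) (trans (index-cong e) (index-elem j))

  decide : ∀ a b → Dec (a ~ b)
  decide a b = map′ index-injective index-cong (index a Finₚ.≟ index b)

  search : {P : A → Set} → (∀ a → Dec (P a)) → (∀ {a b} → a ~ b → P a → P b) → Dec (∃ P)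
  search P? resp = map′ (λ (i , p) → elem i , p)
    (λ (a , p) → index a , resp (index-injective (sym (index-elem (index a)))) p)
    (Finₚ.any? (λ i → P? (elem i)))

open Size

size-≤ : {A B : Set} {_~_ : A → A → Set} {_≋_ : B → B → Set} {m n : ℕ} →
         Size _~_ m → Size _≋_ n → (h : A → B) → (∀ a b → h a ≋ h b → a ~ b) → m ≤ n
size-≤ S T h h-inj = Finₚ.injective⇒≤ {f = λ i → index T (h (elem S i))}
  (λ e → elem-injective S (h-inj _ _ (index-injective T e)))

size-Fin : ∀ n → Size {Fin n} _≡_ n
size-Fin n = record { index = λ i → i ; elem = λ i → i ; index-cong = λ e → e
                    ; index-injective = λ e → e ; index-elem = λ _ → refl }

size-× : {A B : Set} {m n : ℕ} → Size {A} _≡_ m → Size {B} _≡_ n → Size {A × B} _≡_ (m ℕ.* n)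
size-× {m = m} {n} S T = record
  { index           = λ (a , b) → Fin.combine (index S a) (index T b)
  ; elem            = λ k → elem S (proj₁ (Fin.remQuot {m} n k)) , elem T (proj₂ (Fin.remQuot {m} n k))
  ; index-cong      = λ { refl → refl }
  ; index-injective = λ e → cong₂ _,_
      (index-injective S (Finₚ.combine-injectiveˡ (index S _) (index T _) (index S _) (index T _) e))
      (index-injective T (Finₚ.combine-injectiveʳ (index S _) (index T _) (index S _) (index T _) e))
  ; index-elem      = λ k → trans (cong₂ Fin.combine (index-elem S _) (index-elem T _))
                                  (Finₚ.combine-remQuot {m} n k)
  }

funToFin-cong : ∀ {m n} {f g : Fin m → Fin n} → (∀ i → f i ≡ g i) → Fin.funToFin f ≡ Fin.funToFin g
funToFin-cong {zero}  e = refl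
funToFin-cong {suc m} e = cong₂ Fin.combine (e Fin.zero) (funToFin-cong (λ i → e (Fin.suc i)))

size-→ : {A : Set} {n : ℕ} (r : ℕ) → Size {A} _≡_ n →
         Size {Fin r → A} (λ f g → ∀ i → f i ≡ g i) (n ℕ.^ r)
size-→ r S = record
  { index           = λ f → Fin.funToFin (λ i → index S (f i))
  ; elem            = λ k i → elem S (Fin.finToFun k i)
  ; index-cong      = λ e → funToFin-cong (λ i → index-cong S (e i))
  ; index-injective = λ {f} {g} e i → index-injective S
      (trans (sym (Finₚ.finToFun-funToFin (λ j → index S (f j)) i))
        (trans (cong (λ k → Fin.finToFun k i) e) (Finₚ.finToFun-funToFin (λ j → index S (g j)) i)))
  ; index-elem      = λ k → trans (funToFin-cong {r} (λ i → index-elem S _)) (Finₚ.funToFin-finToFin {r} k)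
  }

size-Fin-subset : ∀ n {P : Fin n → Set} → (∀ i → Dec (P i)) →
                  ∃ λ m → Size {Σ (Fin n) P} (λ a b → proj₁ a ≡ proj₁ b) m
size-Fin-subset zero P? = 0 , record
  { index = λ (i , _) → i ; elem = λ () ; index-cong = λ { {() , _} } ; index-injective = λ { {() , _} }
  ; index-elem = λ () }
size-Fin-subset (suc n) {P} P? with size-Fin-subset n (λ i → P? (Fin.suc i)) | P? Fin.zero
... | m , S | no ¬p = m , record
  { index           = ind
  ; elem            = λ i → Fin.suc (proj₁ (elem S i)) , proj₂ (elem S i)
  ; index-cong      = λ {a} {b} → ind-cong a b
  ; index-injective = λ {a} {b} → ind-inj a b
  ; index-elem      = index-elem S
  }
  where
  ind : Σ (Fin (suc n)) P → Fin m
  ind (Fin.zero  , p) = ⊥-elim (¬p p)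
  ind (Fin.suc i , p) = index S (i , p)
  ind-cong : ∀ a b → proj₁ a ≡ proj₁ b → ind a ≡ ind b
  ind-cong (Fin.zero  , p) _ _ = ⊥-elim (¬p p)
  ind-cong (Fin.suc i , p) (Fin.suc .i , p') refl = index-cong S refl
  ind-inj : ∀ a b → ind a ≡ ind b → proj₁ a ≡ proj₁ b
  ind-inj (Fin.zero  , p) _ _ = ⊥-elim (¬p p)
  ind-inj (Fin.suc i , p) (Fin.zero , p') _ = ⊥-elim (¬p p')
  ind-inj (Fin.suc i , p) (Fin.suc j , p') e = cong Fin.suc (index-injective S e)
... | m , S | yes p₀ = suc m , record
  { index           = ind
  ; elem            = el
  ; index-cong      = λ {a} {b} → ind-cong a b
  ; index-injective = λ {a} {b} → ind-inj a b
  ; index-elem      = λ { Fin.zero → refl ; (Fin.suc i) → cong Fin.suc (index-elem S i) }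
  }
  where
  ind : Σ (Fin (suc n)) P → Fin (suc m)
  ind (Fin.zero  , p) = Fin.zero
  ind (Fin.suc i , p) = Fin.suc (index S (i , p))
  el : Fin (suc m) → Σ (Fin (suc n)) P
  el Fin.zero    = Fin.zero , p₀
  el (Fin.suc i) = Fin.suc (proj₁ (elem S i)) , proj₂ (elem S i)
  ind-cong : ∀ a b → proj₁ a ≡ proj₁ b → ind a ≡ ind b
  ind-cong (Fin.zero  , p) (Fin.zero , p') _ = refl
  ind-cong (Fin.suc i , p) (Fin.suc .i , p') refl = cong Fin.suc (index-cong S refl)
  ind-inj : ∀ a b → ind a ≡ ind b → proj₁ a ≡ proj₁ b
  ind-inj (Fin.zero  , p) (Fin.zero , p') _ = refl
  ind-inj (Fin.suc i , p) (Fin.suc j , p') e = cong Fin.suc (index-injective S (Finₚ.suc-injective e))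

size-subset : {A : Set} {n : ℕ} → Size {A} _≡_ n → {P : A → Set} → (∀ a → Dec (P a)) →
              (∀ {a} (p p' : P a) → p ≡ p') → ∃ λ m → Size {Σ A P} _≡_ m
size-subset {A} {n} S {P} P? irr with size-Fin-subset n (λ i → P? (elem S i))
... | m , T = m , record
  { index           = ind
  ; elem            = λ i → elem S (proj₁ (elem T i)) , proj₂ (elem T i)
  ; index-cong      = λ { refl → refl }
  ; index-injective = λ {a} {b} e → proj₁-injective irr (index-injective S (index-injective T e))
  ; index-elem      = λ i → trans (index-cong T (index-elem S (proj₁ (elem T i)))) (index-elem T i)
  }
  where
  ind : Σ A P → Fin m
  ind (a , p) = index T (index S a , subst P (sym (elem-index S a)) p)

↔⇒size : {A : Set} {n : ℕ} → Fin n ↔ A → Size {A} _≡_ n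
↔⇒size bij = record
  { index           = from
  ; elem            = to
  ; index-cong      = cong from
  ; index-injective = λ {a} {b} e → trans (sym (strictlyInverseˡ a)) (trans (cong to e) (strictlyInverseˡ b))
  ; index-elem      = strictlyInverseʳ
  }
  where open Inverse bij

-- Finite fields: Frobenius and Fermat

absorption : ∀ n k → suc k ℕ.* (suc n C suc k) ≡ suc n ℕ.* (n C k)
absorption n zero = begin
  1 ℕ.* (suc n C 1)  ≡⟨ cong (1 ℕ.*_) (nC1≡n (suc n)) ⟩
  1 ℕ.* suc n        ≡⟨ ℕₚ.*-comm 1 (suc n) ⟩
  suc n ℕ.* 1        ≡⟨ cong (suc n ℕ.*_) (trans (sym (nCn≡1 n)) (trans (nCk≡nC[n∸k] {n} {n} ℕₚ.≤-refl) (cong (n C_) (ℕₚ.n∸n≡0 n)))) ⟩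
  suc n ℕ.* (n C 0)  ∎
  where open ≡-Reasoning
absorption zero (suc k) = trans (ℕₚ.*-zeroʳ k) refl
absorption (suc n) (suc k) = begin
  (2 ℕ.+ k) ℕ.* (suc (suc n) C suc (suc k))
    ≡⟨ cong ((2 ℕ.+ k) ℕ.*_) (sym (nCk+nC[k+1]≡[n+1]C[k+1] (suc n) (suc k))) ⟩
  (2 ℕ.+ k) ℕ.* (c ℕ.+ (suc n C suc (suc k)))
    ≡⟨ distrib k c _ ⟩
  c ℕ.+ (suc k ℕ.* c ℕ.+ (2 ℕ.+ k) ℕ.* (suc n C suc (suc k)))
    ≡⟨ cong (c ℕ.+_) (cong₂ ℕ._+_ (absorption n k) (absorption n (suc k))) ⟩
  c ℕ.+ (suc n ℕ.* (n C k) ℕ.+ suc n ℕ.* (n C suc k))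
    ≡⟨ cong (c ℕ.+_) (sym (ℕₚ.*-distribˡ-+ (suc n) (n C k) (n C suc k))) ⟩
  c ℕ.+ suc n ℕ.* ((n C k) ℕ.+ (n C suc k))
    ≡⟨ cong (λ z → c ℕ.+ suc n ℕ.* z) (nCk+nC[k+1]≡[n+1]C[k+1] n k) ⟩
  suc (suc n) ℕ.* c
    ∎
  where
  open ≡-Reasoning
  c = suc n C suc k
  distrib : ∀ k a b → (2 ℕ.+ k) ℕ.* (a ℕ.+ b) ≡ a ℕ.+ (suc k ℕ.* a ℕ.+ (2 ℕ.+ k) ℕ.* b)
  distrib = solve-∀

-- By `absorption` the prime divides `suc k` times the coefficient, and it is too large to divide
-- `suc k`.
prime∣C : ∀ {n k} → Prime (suc n) → k < n → suc n ∣ (suc n C suc k)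
prime∣C {n} {k} pr k<n
  with euclidsLemma (suc k) (suc n C suc k) pr (subst (suc n ∣_) (sym (absorption n k)) (m∣m*n (n C k)))
... | inj₁ p∣k = contradiction (∣⇒≤ p∣k) (ℕₚ.<⇒≱ (s≤s k<n))
... | inj₂ p∣C = p∣C

module FieldTheory (F : Field) where

  open FF F public

  commutativeRing : CommutativeRing 0ℓ 0ℓ
  commutativeRing = record { isCommutativeRing = isCommutativeRing }

  open CommutativeRing commutativeRing public
    using (+-comm; +-assoc; +-identityˡ; +-identityʳ; -‿inverseˡ; -‿inverseʳ; *-comm; *-assoc
          ; *-identityˡ; *-identityʳ; zeroˡ; zeroʳ; distribˡ; distribʳ
          ; commutativeSemiring; semiring; +-commutativeMonoid; *-commutativeMonoid; +-group; ring)

  open import Algebra.Properties.Group +-group public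
    using (inverseʳ-unique; inverseˡ-unique)
    renaming (∙-cancelˡ to +-cancelˡ; ∙-cancelʳ to +-cancelʳ; x∙y⁻¹≈ε⇒x≈y to x-y≡0⇒x≡y)
  open import Algebra.Properties.Ring ring public using (-1*x≈-x; -‿distribˡ-*; -‿distribʳ-*)
  open import Algebra.Solver.Ring.NaturalCoefficients.Default commutativeSemiring public
    using (solve; con; _:=_; _:+_; _:*_)

  import Algebra.Properties.Semiring.Exp
  import Algebra.Properties.Semiring.Mult
  private
    module S  = Algebra.Properties.Semiring.Exp semiring
    module M  = Algebra.Properties.Semiring.Mult semiring

  x-y+y≡x : ∀ x y → x + - y + y ≡ x
  x-y+y≡x x y = trans (+-assoc x (- y) y) (trans (cong (x +_) (-‿inverseˡ y)) (+-identityʳ x))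

  x*y≡0⇒y≡0 : ∀ {x y} → ¬ x ≡ 0# → x * y ≡ 0# → y ≡ 0#
  x*y≡0⇒y≡0 {x} {y} x≢0 e = begin
    y                ≡⟨ sym (*-identityˡ y) ⟩
    1# * y           ≡⟨ cong (_* y) (sym (⁻¹-inverse x x≢0)) ⟩
    x * x ⁻¹ * y     ≡⟨ solve 3 (λ x i y → x :* i :* y := i :* (x :* y)) refl x (x ⁻¹) y ⟩
    x ⁻¹ * (x * y)   ≡⟨ cong (x ⁻¹ *_) e ⟩
    x ⁻¹ * 0#        ≡⟨ zeroʳ _ ⟩
    0#               ∎
    where open ≡-Reasoning

  x*y≢0 : ∀ {x y} → ¬ x ≡ 0# → ¬ y ≡ 0# → ¬ x * y ≡ 0#
  x*y≢0 x≢0 y≢0 e = y≢0 (x*y≡0⇒y≡0 x≢0 e)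

  ⁻¹-inverseˡ : ∀ {x} → ¬ x ≡ 0# → x ⁻¹ * x ≡ 1#
  ⁻¹-inverseˡ {x} x≢0 = trans (*-comm (x ⁻¹) x) (⁻¹-inverse x x≢0)

  x⁻¹≢0 : ∀ {x} → ¬ x ≡ 0# → ¬ x ⁻¹ ≡ 0#
  x⁻¹≢0 {x} x≢0 e = 0≢1 (trans (sym (zeroʳ x)) (trans (cong (x *_) (sym e)) (⁻¹-inverse x x≢0)))

  *-cancelˡ : ∀ {z x y} → ¬ z ≡ 0# → z * x ≡ z * y → x ≡ y
  *-cancelˡ {z} {x} {y} z≢0 e = begin
    x               ≡⟨ unit x ⟩
    z ⁻¹ * (z * x)  ≡⟨ cong (z ⁻¹ *_) e ⟩
    z ⁻¹ * (z * y)  ≡⟨ sym (unit y) ⟩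
    y               ∎
    where
    open ≡-Reasoning
    unit : ∀ w → w ≡ z ⁻¹ * (z * w)
    unit w = trans (sym (*-identityˡ w))
      (trans (cong (_* w) (sym (⁻¹-inverseˡ z≢0))) (*-assoc _ _ _))

  *-cancelʳ : ∀ {z x y} → ¬ z ≡ 0# → x * z ≡ y * z → x ≡ y
  *-cancelʳ {z} z≢0 e = *-cancelˡ z≢0 (trans (*-comm z _) (trans e (*-comm _ z)))

  x*y⁻¹*y≡x : ∀ x {y} → ¬ y ≡ 0# → x * y ⁻¹ * y ≡ x
  x*y⁻¹*y≡x x y≢0 = trans (*-assoc x _ _) (trans (cong (x *_) (⁻¹-inverseˡ y≢0)) (*-identityʳ x))

  ^-distrib-* : ∀ x y n → (x * y) ^ n ≡ x ^ n * y ^ n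
  ^-distrib-* x y zero    = sym (*-identityˡ 1#)
  ^-distrib-* x y (suc n) = trans (cong (x * y *_) (^-distrib-* x y n))
    (solve 4 (λ x y a b → x :* y :* (a :* b) := x :* a :* (y :* b)) refl x y (x ^ n) (y ^ n))

  ^-homo-* : ∀ x m n → x ^ (m ℕ.+ n) ≡ x ^ m * x ^ n
  ^-homo-* x zero    n = sym (*-identityˡ _)
  ^-homo-* x (suc m) n = trans (cong (x *_) (^-homo-* x m n)) (sym (*-assoc _ _ _))

  1^ : ∀ n → 1# ^ n ≡ 1#
  1^ zero    = refl
  1^ (suc n) = trans (*-identityˡ _) (1^ n)

  0^ : ∀ n → 0 < n → 0# ^ n ≡ 0#
  0^ (suc n) _ = zeroˡ _

  ^-* : ∀ x m n → x ^ (m ℕ.* n) ≡ (x ^ m) ^ n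
  ^-* x zero    n = sym (1^ n)
  ^-* x (suc m) n = trans (^-homo-* x n (m ℕ.* n))
    (trans (cong (x ^ n *_) (^-* x m n)) (sym (^-distrib-* x (x ^ m) n)))

  x^n≡0⇒x≡0 : (∀ x → Dec (x ≡ 0#)) → ∀ x n → x ^ n ≡ 0# → x ≡ 0#
  x^n≡0⇒x≡0 _≟0 x zero    e = contradiction (sym e) 0≢1
  x^n≡0⇒x≡0 _≟0 x (suc n) e with x ≟0
  ... | yes x≡0 = x≡0
  ... | no  x≢0 = x^n≡0⇒x≡0 _≟0 x n (x*y≡0⇒y≡0 x≢0 e)

  private
    ^≡S^ : ∀ x n → x ^ n ≡ x S.^ n
    ^≡S^ x zero    = refl
    ^≡S^ x (suc n) = cong (x *_) (^≡S^ x n)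

  module _ {p} (prime : Prime p) (p×1≡0 : p M.× 1# ≡ 0#) where

    p∣n⇒n×x≡0 : ∀ {n} x → p ∣ n → n M.× x ≡ 0#
    p∣n⇒n×x≡0 {n} x (divides k refl) = begin
      (k ℕ.* p) M.× x          ≡⟨ cong ((k ℕ.* p) M.×_) (sym (*-identityˡ x)) ⟩
      (k ℕ.* p) M.× (1# * x)   ≡⟨ sym (M.×-assoc-* (k ℕ.* p) 1# x) ⟩
      (k ℕ.* p) M.× 1# * x     ≡⟨ cong (_* x) (M.×1-homo-* k p) ⟩
      k M.× 1# * (p M.× 1#) * x  ≡⟨ cong (λ z → k M.× 1# * z * x) p×1≡0 ⟩
      k M.× 1# * 0# * x        ≡⟨ cong (_* x) (zeroʳ _) ⟩
      0# * x                   ≡⟨ zeroˡ x ⟩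
      0#                       ∎
      where open ≡-Reasoning

    freshman : ∀ x y → (x + y) ^ p ≡ x ^ p + y ^ p
    freshman x y = go p prime p∣n⇒n×x≡0
      where
      import Algebra.Properties.CommutativeSemiring.Binomial commutativeSemiring as B
      import Algebra.Properties.Semiring.Sum semiring as Σ′
      open ≡-Reasoning
      -- The prime is generalised here so that it can be matched as a successor, with the vanishing
      -- of its multiples passed along as a hypothesis.
      go : ∀ p → Prime p → (∀ {n} x → p ∣ n → n M.× x ≡ 0#) → (x + y) ^ p ≡ x ^ p + y ^ p
      go (suc n) pr van = begin
        (x + y) ^ suc n                             ≡⟨ ^≡S^ (x + y) (suc n) ⟩
        (x + y) S.^ suc n                           ≡⟨ B.theorem (suc n) x y ⟩
        term Fin.zero + Σ′.sum tail                 ≡⟨ cong₂ _+_ first (Σ′.sum-init-last tail) ⟩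
        y ^ suc n + (Σ′.sum init′ + tail (Fin.fromℕ n)) ≡⟨ cong (y ^ suc n +_) (cong₂ _+_ middle last′) ⟩
        y ^ suc n + (0# + x ^ suc n)
          ≡⟨ solve 2 (λ a b → a :+ (con 0 :+ b) := b :+ a) refl (y ^ suc n) (x ^ suc n) ⟩
        x ^ suc n + y ^ suc n                       ∎
        where
        term : Fin (suc (suc n)) → Carrier
        term = B.binomialTerm x y (suc n)
        tail : Fin (suc n) → Carrier
        tail i = term (Fin.suc i)
        init′ : Fin n → Carrier
        init′ i = tail (Fin.inject₁ i)
        first : term Fin.zero ≡ y ^ suc n
        first = begin
          (suc n C 0) M.× (1# * y S.^ suc n)
            ≡⟨ cong (M._× (1# * y S.^ suc n)) (trans (trans (cong (suc n C_) (sym (ℕₚ.n∸n≡0 (suc n))))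
                 (sym (nCk≡nC[n∸k] {suc n} {suc n} ℕₚ.≤-refl))) (nCn≡1 (suc n))) ⟩
          1# * y S.^ suc n + 0#   ≡⟨ trans (+-identityʳ _) (*-identityˡ _) ⟩
          y S.^ suc n             ≡⟨ sym (^≡S^ y (suc n)) ⟩
          y ^ suc n               ∎
        middle : Σ′.sum init′ ≡ 0#
        middle = trans (Σ′.sum-cong-≗ (λ i → van _ (prime∣C pr (subst (_< n) (sym (Finₚ.toℕ-inject₁ i)) (Finₚ.toℕ<n i)))))
                       (Σ′.sum-replicate-zero n)
        last′ : tail (Fin.fromℕ n) ≡ x ^ suc n
        last′ rewrite Finₚ.toℕ-fromℕ n | nCn≡1 (suc n) | ℕₚ.n∸n≡0 n =
          trans (+-identityʳ _) (trans (*-identityʳ _) (sym (^≡S^ x (suc n))))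

  Frobenius : ℕ → Set
  Frobenius Q = ∀ x y → (x + y) ^ Q ≡ x ^ Q + y ^ Q

  frobenius-^ : ∀ {Q} → Frobenius Q → ∀ e → Frobenius (Q ℕ.^ e)
  frobenius-^ {Q} frob zero x y = solve 2 (λ x y → (x :+ y) :* con 1 := x :* con 1 :+ y :* con 1) refl x y
  frobenius-^ {Q} frob (suc e) x y = begin
    (x + y) ^ (Q ℕ.* Q ℕ.^ e)                     ≡⟨ ^-* (x + y) Q (Q ℕ.^ e) ⟩
    ((x + y) ^ Q) ^ (Q ℕ.^ e)                     ≡⟨ cong (_^ (Q ℕ.^ e)) (frob x y) ⟩
    (x ^ Q + y ^ Q) ^ (Q ℕ.^ e)                   ≡⟨ frobenius-^ frob e (x ^ Q) (y ^ Q) ⟩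
    (x ^ Q) ^ (Q ℕ.^ e) + (y ^ Q) ^ (Q ℕ.^ e)     ≡⟨ sym (cong₂ _+_ (^-* x Q (Q ℕ.^ e)) (^-* y Q (Q ℕ.^ e))) ⟩
    x ^ (Q ℕ.* Q ℕ.^ e) + y ^ (Q ℕ.* Q ℕ.^ e)     ∎
    where open ≡-Reasoning

  module Finite {n} (size : Size {Carrier} _≡_ n) where

    _≟_ : ∀ x y → Dec (x ≡ y)
    _≟_ = decide size

    relabel : (h g : Carrier → Carrier) → (∀ x → h (g x) ≡ x) → (∀ x → g (h x) ≡ x) → Permutation n n
    relabel h g hg gh = permutation (λ i → index size (h (elem size i))) (λ i → index size (g (elem size i)))
      (λ i → trans (cong (λ x → index size (h x)) (elem-index size _)) (trans (cong (index size) (hg _)) (index-elem size i)))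
      (λ i → trans (cong (λ x → index size (g x)) (elem-index size _)) (trans (cong (index size) (gh _)) (index-elem size i)))

    -- Translation by 1 permutes the field, so the sum of all elements does not change when 1 is
    -- added to each of its n terms.
    n×1≡0 : n M.× 1# ≡ 0#
    n×1≡0 = +-cancelˡ total _ _ (begin
      total + n M.× 1#
        ≡⟨ cong (total +_) (sym (Σ′.sum-replicate n)) ⟩
      total + Σ′.sum {n} (λ _ → 1#)
        ≡⟨ sym (Σ′.∑-distrib-+ (elem size) (λ _ → 1#)) ⟩
      Σ′.sum (λ i → elem size i + 1#)
        ≡⟨ sym (Σ′.sum-cong-≗ {n} (λ i → elem-index size _)) ⟩
      Σ′.sum (λ i → elem size (shift ⟨$⟩ʳ i))
        ≡⟨ sym (Σ′.sum-permute (elem size) shift) ⟩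
      total
        ≡⟨ sym (+-identityʳ total) ⟩
      total + 0#
        ∎)
      where
      import Algebra.Properties.CommutativeMonoid.Sum +-commutativeMonoid as Σ′
      open ≡-Reasoning
      total : Carrier
      total = Σ′.sum (elem size)
      shift : Permutation n n
      shift = relabel (_+ 1#) (_+ - 1#)
        (λ x → trans (+-assoc _ _ _) (trans (cong (x +_) (-‿inverseˡ 1#)) (+-identityʳ x)))
        (λ x → trans (+-assoc _ _ _) (trans (cong (x +_) (-‿inverseʳ 1#)) (+-identityʳ x)))

    -- The k-th power of p times 1 is n times 1, hence zero, and a field has no nonzero nilpotents.
    p^k≡n⇒p×1≡0 : ∀ p k → p ℕ.^ k ≡ n → p M.× 1# ≡ 0#
    p^k≡n⇒p×1≡0 p k e = x^n≡0⇒x≡0 (_≟ 0#) _ k (trans (sym (power k)) (trans (cong (M._× 1#) e) n×1≡0))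
      where
      power : ∀ k → (p ℕ.^ k) M.× 1# ≡ (p M.× 1#) ^ k
      power zero    = +-identityʳ 1#
      power (suc k) = trans (M.×1-homo-* p (p ℕ.^ k)) (cong (p M.× 1# *_) (power k))

    private
      import Algebra.Properties.CommutativeMonoid.Sum
      -- The monoid is the multiplicative one, so `Π.sum` is a product.
      module Π = Algebra.Properties.CommutativeMonoid.Sum *-commutativeMonoid

      Π-singleton : ∀ {m} (f : Fin m → Carrier) i → (∀ j → ¬ j ≡ i → f j ≡ 1#) → Π.sum f ≡ f i
      Π-singleton {suc m} f i one = begin
        Π.sum f                                   ≡⟨ Π.sum-remove {i = i} f ⟩
        f i * Π.sum (λ j → f (Fin.punchIn i j))   ≡⟨ cong (f i *_) (Π.sum-cong-≗ (λ j → one _ (Finₚ.punchInᵢ≢i i j))) ⟩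
        f i * Π.sum {m} (λ _ → 1#)                ≡⟨ cong (f i *_) (Π.sum-replicate-zero m) ⟩
        f i * 1#                                  ≡⟨ *-identityʳ _ ⟩
        f i                                       ∎
        where open ≡-Reasoning

      Π≢0 : ∀ {m} (f : Fin m → Carrier) → (∀ j → ¬ f j ≡ 0#) → ¬ Π.sum f ≡ 0#
      Π≢0 {zero}  f nz e = 0≢1 (sym e)
      Π≢0 {suc m} f nz   = x*y≢0 (nz Fin.zero) (Π≢0 (λ j → f (Fin.suc j)) (λ j → nz (Fin.suc j)))

      Π-const : ∀ m {a} → Π.sum {m} (λ _ → a) ≡ a ^ m
      Π-const zero    = refl
      Π-const (suc m) = cong (_ *_) (Π-const m)

      if0 : Carrier → Carrier → Carrier → Carrier
      if0 u v y with y ≟ 0#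
      ... | yes _ = u
      ... | no  _ = v

      if0-yes : ∀ {u v y} → y ≡ 0# → if0 u v y ≡ u
      if0-yes {y = y} e with y ≟ 0#
      ... | yes _ = refl
      ... | no ¬e = contradiction e ¬e

      if0-no : ∀ {u v y} → ¬ y ≡ 0# → if0 u v y ≡ v
      if0-no {y = y} ¬e with y ≟ 0#
      ... | yes e = contradiction e ¬e
      ... | no _  = refl

    0<size : 0 < n
    0<size = ℕₚ.≤-trans (s≤s z≤n) (Finₚ.toℕ<n (index size 0#))

    -- Multiplication by a permutes the field. In the product over all elements, 0 is replaced
    -- by 1; the factor if0 a 1# y compensates for a * 0 being replaced as well.
    fermat : ∀ a → a ^ n ≡ a
    fermat a with a ≟ 0#
    ... | yes refl = 0^ n 0<size
    ... | no a≢0 = *-cancelʳ total≢0 (begin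
      a ^ n * total
        ≡⟨ cong (_* total) (sym (Π-const n)) ⟩
      Π.sum {n} (λ _ → a) * total
        ≡⟨ sym (Π.∑-distrib-+ {n} (λ _ → a) (λ i → unit (elem size i))) ⟩
      Π.sum (λ i → a * unit (elem size i))
        ≡⟨ Π.sum-cong-≗ {n} (λ i → scale (elem size i)) ⟩
      Π.sum (λ i → if0 a 1# (elem size i) * unit (a * elem size i))
        ≡⟨ Π.∑-distrib-+ {n} (λ i → if0 a 1# (elem size i)) (λ i → unit (a * elem size i)) ⟩
      Π.sum (λ i → if0 a 1# (elem size i)) * Π.sum (λ i → unit (a * elem size i))
        ≡⟨ cong₂ _*_ single permuted ⟩
      a * total
        ∎)
      where
      open ≡-Reasoning
      unit : Carrier → Carrier
      unit y = if0 1# y y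
      total : Carrier
      total = Π.sum (λ i → unit (elem size i))
      total≢0 : ¬ total ≡ 0#
      total≢0 = Π≢0 {n} _ (λ j → unit≢0 (elem size j))
        where
        unit≢0 : ∀ y → ¬ unit y ≡ 0#
        unit≢0 y e with y ≟ 0#
        ... | yes _  = 0≢1 (sym e)
        ... | no y≢0 = y≢0 e
      scale : ∀ y → a * unit y ≡ if0 a 1# y * unit (a * y)
      scale y with y ≟ 0#
      ... | yes y≡0 = cong (a *_) (sym (if0-yes (trans (cong (a *_) y≡0) (zeroʳ a))))
      ... | no y≢0  = sym (trans (*-identityˡ _) (if0-no (x*y≢0 a≢0 y≢0)))
      single : Π.sum (λ i → if0 a 1# (elem size i)) ≡ a
      single = trans (Π-singleton {n} _ (index size 0#)
          (λ j j≢ → if0-no (λ e → j≢ (trans (sym (index-elem size j)) (cong (index size) e)))))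
        (if0-yes (elem-index size 0#))
      times : Permutation n n
      times = relabel (a *_) (a ⁻¹ *_)
        (λ x → trans (sym (*-assoc _ _ _)) (trans (cong (_* x) (⁻¹-inverse a a≢0)) (*-identityˡ x)))
        (λ x → trans (sym (*-assoc _ _ _)) (trans (cong (_* x) (⁻¹-inverseˡ a≢0)) (*-identityˡ x)))
      permuted : Π.sum (λ i → unit (a * elem size i)) ≡ total
      permuted = trans (Π.sum-cong-≗ {n} (λ i → cong unit (sym (elem-index size _))))
        (sym (Π.sum-permute (λ i → unit (elem size i)) times))

-- Roots of polynomial functions and the order of a subfield

module Polynomials (F : Field) where

  open FieldTheory F public

  -- A polynomial function of degree d is one that, for every a, is f(a) plus x - a times a
  -- polynomial function of degree d - 1; no coefficients are needed for the root bound.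
  Degree< : ℕ → (Carrier → Carrier) → Set
  Degree< zero    f = ∀ x → f x ≡ 0#
  Degree< (suc d) f = ∀ a → ∃ λ g → Degree< d g × (∀ x → f x ≡ (x + - a) * g x + f a)

  -- Ending the chain of quotients in 1 instead of 0 records the leading coefficient, without which
  -- there is no bound on the roots.
  Monic : ℕ → (Carrier → Carrier) → Set
  Monic zero    f = ∀ x → f x ≡ 1#
  Monic (suc d) f = ∀ a → ∃ λ g → Monic d g × (∀ x → f x ≡ (x + - a) * g x + f a)

  degree<-suc : ∀ d {f} → Degree< d f → Degree< (suc d) f
  degree<-suc zero    {f} f≡0 a = (λ _ → 0#) , (λ _ → refl) , λ x →
    trans (f≡0 x) (sym (trans (cong₂ _+_ (zeroʳ _) (f≡0 a)) (+-identityˡ 0#)))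
  degree<-suc (suc d) f< a with f< a
  ... | g , g< , eq = g , degree<-suc d g< , eq

  degree<-mono : ∀ {d e f} → d ≤ e → Degree< d f → Degree< e f
  degree<-mono {d} {e} d≤e f< with ℕₚ.≤⇒≤′ d≤e
  ... | ℕ.≤′-refl = f<
  ... | ℕ.≤′-step {e′} d≤e′ = degree<-suc e′ (degree<-mono (ℕₚ.≤′⇒≤ d≤e′) f<)

  monic⇒degree< : ∀ d {f} → Monic d f → Degree< (suc d) f
  monic⇒degree< zero    f≡1 a = (λ _ → 0#) , (λ _ → refl) , λ x →
    trans (f≡1 x) (sym (trans (cong₂ _+_ (zeroʳ _) (f≡1 a)) (+-identityˡ 1#)))
  monic⇒degree< (suc d) mf a with mf a
  ... | g , mg , eq = g , monic⇒degree< d mg , eq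

  private
    add-quotients : ∀ {f h g k : Carrier → Carrier} {a} →
      (∀ x → f x ≡ (x + - a) * g x + f a) → (∀ x → h x ≡ (x + - a) * k x + h a) →
      ∀ x → f x + h x ≡ (x + - a) * (g x + k x) + (f a + h a)
    add-quotients eq eq′ x = trans (cong₂ _+_ (eq x) (eq′ x))
      (solve 5 (λ z g fa k ha → (z :* g :+ fa) :+ (z :* k :+ ha) := z :* (g :+ k) :+ (fa :+ ha)) refl _ _ _ _ _)

  degree<-+ : ∀ d {f h} → Degree< d f → Degree< d h → Degree< d (λ x → f x + h x)
  degree<-+ zero    f≡0 h≡0 x = trans (cong₂ _+_ (f≡0 x) (h≡0 x)) (+-identityˡ 0#)
  degree<-+ (suc d) {f} {h} f< h< a with f< a | h< a
  ... | g , g< , eq | k , k< , eq′ = _ , degree<-+ d g< k< , add-quotients {f} {h} eq eq′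

  monic-+ : ∀ d {f h} → Monic d f → Degree< d h → Monic d (λ x → f x + h x)
  monic-+ zero    f≡1 h≡0 x = trans (cong₂ _+_ (f≡1 x) (h≡0 x)) (+-identityʳ 1#)
  monic-+ (suc d) {f} {h} mf h< a with mf a | h< a
  ... | g , mg , eq | k , k< , eq′ = _ , monic-+ d mg k< , add-quotients {f} {h} eq eq′

  degree<-scale : ∀ d c {f} → Degree< d f → Degree< d (λ x → c * f x)
  degree<-scale zero    c f≡0 x = trans (cong (c *_) (f≡0 x)) (zeroʳ c)
  degree<-scale (suc d) c {f} f< a with f< a
  ... | g , g< , eq = _ , degree<-scale d c g< , λ x → trans (cong (c *_) (eq x))
    (solve 4 (λ c z g fa → c :* (z :* g :+ fa) := z :* (c :* g) :+ c :* fa) refl c (x + - a) (g x) (f a))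

  -- Writing x as (x - a) + a turns x f(x) into (x - a)(f(x) + a g(x)) + a f(a), where g is the
  -- quotient of f at a.
  monic-var* : ∀ d {f} → Monic d f → Monic (suc d) (λ x → x * f x)
  monic-var* zero {f} f≡1 a = (λ _ → 1#) , (λ _ → refl) , λ x → begin
    x * f x                      ≡⟨ cong (x *_) (f≡1 x) ⟩
    x * 1#                       ≡⟨ cong (_* 1#) (sym (x-y+y≡x x a)) ⟩
    ((x + - a) + a) * 1#         ≡⟨ distribʳ 1# (x + - a) a ⟩
    (x + - a) * 1# + a * 1#      ≡⟨ cong (λ z → (x + - a) * 1# + a * z) (sym (f≡1 a)) ⟩
    (x + - a) * 1# + a * f a     ∎
    where open ≡-Reasoning
  monic-var* (suc d) {f} mf a with mf a
  ... | g , mg , eq = (λ x → f x + a * g x)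
    , monic-+ (suc d) {f} mf (degree<-scale (suc d) a (monic⇒degree< d mg)) , λ x → begin
    x * f x                                      ≡⟨ cong (_* f x) (sym (x-y+y≡x x a)) ⟩
    ((x + - a) + a) * f x                        ≡⟨ distribʳ _ _ _ ⟩
    (x + - a) * f x + a * f x                    ≡⟨ cong (λ z → (x + - a) * f x + a * z) (eq x) ⟩
    (x + - a) * f x + a * ((x + - a) * g x + f a)
      ≡⟨ solve 5 (λ z a f g fa → z :* f :+ a :* (z :* g :+ fa) := z :* (f :+ a :* g) :+ a :* fa) refl
           (x + - a) a (f x) (g x) (f a) ⟩
    (x + - a) * (f x + a * g x) + a * f a        ∎
    where open ≡-Reasoning

  monic-^ : ∀ d → Monic d (_^ d)
  monic-^ zero    x = refl
  monic-^ (suc d) = monic-var* d (monic-^ d)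

  -- Factoring at the first root leaves the others as roots of the quotient, because they differ
  -- from it and there are no zero divisors.
  roots≤degree : ∀ d {f m} → Monic d f → (r : Fin m → Carrier) → (∀ i j → r i ≡ r j → i ≡ j) →
                 (∀ i → f (r i) ≡ 0#) → m ≤ d
  roots≤degree d       {m = zero}  _ _ _ _ = z≤n
  roots≤degree zero    {m = suc m} f≡1 r _ root = contradiction (trans (sym (root Fin.zero)) (f≡1 _)) 0≢1
  roots≤degree (suc d) {f} {suc m} mf r r-inj root with mf (r Fin.zero)
  ... | g , mg , eq = s≤s (roots≤degree d mg (λ i → r (Fin.suc i))
    (λ i j e → Finₚ.suc-injective (r-inj _ _ e))
    (λ i → x*y≡0⇒y≡0
      (λ e → Finₚ.0≢1+n (sym (r-inj _ _ (x-y≡0⇒x≡y _ _ e))))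
      (trans (sym (trans (eq (r (Fin.suc i))) (trans (cong (_ +_) (root Fin.zero)) (+-identityʳ _))))
             (root (Fin.suc i)))))

  module Trace (Q : ℕ) where

    trace : ℕ → Carrier → Carrier
    trace zero    x = 0#
    trace (suc s) x = x ^ (Q ℕ.^ s) + trace s x

    trace-degree< : 1 < Q → ∀ s → Degree< (Q ℕ.^ s) (trace s)
    trace-monic : 1 < Q → ∀ s → Monic (Q ℕ.^ s) (trace (suc s))

    trace-degree< 1<Q zero    = degree<-suc 0 (λ _ → refl)
    trace-degree< 1<Q (suc s) = degree<-mono (ℕₚ.^-monoʳ-< Q 1<Q (ℕₚ.n<1+n s)) (monic⇒degree< _ (trace-monic 1<Q s))
    trace-monic 1<Q s = monic-+ _ (monic-^ (Q ℕ.^ s)) (trace-degree< 1<Q s)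

    module _ (0<Q : 0 < Q) (frob : Frobenius Q) where

      trace-+ : ∀ s x y → trace s (x + y) ≡ trace s x + trace s y
      trace-+ zero    x y = sym (+-identityˡ 0#)
      trace-+ (suc s) x y = trans (cong₂ _+_ (frobenius-^ frob s x y) (trace-+ s x y))
        (solve 4 (λ a b c d → (a :+ b) :+ (c :+ d) := (a :+ c) :+ (b :+ d)) refl _ _ _ _)

      -- Raising to the power `Q` shifts the summands by one, so only the end terms differ. When
      -- x^(Q^s) = x, the trace is therefore fixed by that power and lies in the subfield.
      trace-^ : ∀ s x → trace s x ^ Q + x ≡ trace s x + x ^ (Q ℕ.^ s)
      trace-^ zero    x = trans (cong (_+ x) (0^ Q 0<Q)) (cong (0# +_) (sym (*-identityʳ x)))
      trace-^ (suc s) x = begin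
        (xs + trace s x) ^ Q + x               ≡⟨ cong (_+ x) (frob _ _) ⟩
        xs ^ Q + trace s x ^ Q + x             ≡⟨ +-assoc _ _ _ ⟩
        xs ^ Q + (trace s x ^ Q + x)           ≡⟨ cong₂ _+_ (sym (^-* x (Q ℕ.^ s) Q)) (trace-^ s x) ⟩
        x ^ (Q ℕ.^ s ℕ.* Q) + (trace s x + xs) ≡⟨ cong (λ m → x ^ m + (trace s x + xs)) (ℕₚ.*-comm (Q ℕ.^ s) Q) ⟩
        x ^ (Q ℕ.^ suc s) + (trace s x + xs)
          ≡⟨ solve 3 (λ a b c → a :+ (b :+ c) := c :+ b :+ a) refl _ (trace s x) xs ⟩
        xs + trace s x + x ^ (Q ℕ.^ suc s)     ∎
        where
        open ≡-Reasoning
        xs = x ^ (Q ℕ.^ s)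

-- Subfields of a finite field: closure and order

module Subfields {F : Field} {n} (size : Size {Field.Carrier F} _≡_ n) where

  open Polynomials F public
  open Finite size public

  Sub-≡ : ∀ {Q} {x y : Sub Q} → proj₁ x ≡ proj₁ y → x ≡ y
  Sub-≡ = proj₁-injective ≡-irrelevant

  module _ {Q} (0<Q : 0 < Q) (frob : Frobenius Q) where

    0∈Sub : InSub Q 0#
    0∈Sub = 0^ Q 0<Q

    1∈Sub : InSub Q 1#
    1∈Sub = 1^ Q

    +∈Sub : ∀ {x y} → InSub Q x → InSub Q y → InSub Q (x + y)
    +∈Sub p p' = trans (frob _ _) (cong₂ _+_ p p')

    *∈Sub : ∀ {x y} → InSub Q x → InSub Q y → InSub Q (x * y)
    *∈Sub p p' = trans (^-distrib-* _ _ Q) (cong₂ _*_ p p')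

    -^Q : ∀ x → (- x) ^ Q ≡ - (x ^ Q)
    -^Q x = inverseʳ-unique (x ^ Q) ((- x) ^ Q)
      (trans (sym (frob x (- x))) (trans (cong (_^ Q) (-‿inverseʳ x)) 0∈Sub))

    -∈Sub : ∀ {x} → InSub Q x → InSub Q (- x)
    -∈Sub p = trans (-^Q _) (cong -_ p)

    ⁻¹∈Sub : ∀ {x} → ¬ x ≡ 0# → InSub Q x → InSub Q (x ⁻¹)
    ⁻¹∈Sub {x} x≢0 p = *-cancelˡ x≢0 (begin
      x * (x ⁻¹) ^ Q      ≡⟨ cong (_* (x ⁻¹) ^ Q) (sym p) ⟩
      x ^ Q * (x ⁻¹) ^ Q  ≡⟨ sym (^-distrib-* x (x ⁻¹) Q) ⟩
      (x * x ⁻¹) ^ Q      ≡⟨ cong (_^ Q) (⁻¹-inverse x x≢0) ⟩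
      1# ^ Q              ≡⟨ 1∈Sub ⟩
      1#                  ≡⟨ sym (⁻¹-inverse x x≢0) ⟩
      x * x ⁻¹            ∎)
      where open ≡-Reasoning

  InSub? : ∀ Q x → Dec (InSub Q x)
  InSub? Q x = (x ^ Q) ≟ x

  -- The upper bound counts the roots of x^Q - x; the lower bound holds because the trace to
  -- the subfield is a polynomial of degree Q^s, so that at most Q^s elements have trace 0.
  subfield-size : ∀ {Q} s → 1 < Q → Frobenius Q → n ≡ Q ℕ.^ suc s → Size {Sub Q} _≡_ Q
  subfield-size {Q} s 1<Q frob n≡ = subst (Size _≡_) (ℕₚ.≤-antisym m≤Q Q≤m) sub
    where
    open Trace Q
    0<Q : 0 < Q
    0<Q = ℕₚ.<⇒≤ 1<Q
    tr : Carrier → Carrier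
    tr = trace (suc s)
    subs : ∃ λ m → Size {Sub Q} _≡_ m
    subs = size-subset size (InSub? Q) ≡-irrelevant
    m   = proj₁ subs
    sub = proj₂ subs
    kers : ∃ λ m → Size {Σ Carrier λ x → tr x ≡ 0#} _≡_ m
    kers = size-subset size (λ x → tr x ≟ 0#) ≡-irrelevant
    k   = proj₁ kers
    ker = proj₂ kers

    x^Q-x : Monic Q (λ x → x ^ Q + - 1# * x ^ 1)
    x^Q-x = monic-+ Q (monic-^ Q)
      (degree<-mono 1<Q (degree<-scale 2 (- 1#) (monic⇒degree< 1 (monic-^ 1))))

    m≤Q : m ≤ Q
    m≤Q = roots≤degree Q x^Q-x (λ i → proj₁ (elem sub i)) (λ i j e → elem-injective sub (Sub-≡ {Q} e))
      (λ i → root (elem sub i))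
      where
      root : (x : Sub Q) → proj₁ x ^ Q + - 1# * proj₁ x ^ 1 ≡ 0#
      root (x , p) = trans (cong₂ _+_ p (trans (-1*x≈-x _) (cong -_ (*-identityʳ x)))) (-‿inverseʳ x)

    k≤ : k ≤ Q ℕ.^ s
    k≤ = roots≤degree _ (trace-monic 1<Q s) (λ i → proj₁ (elem ker i))
      (λ i j e → elem-injective ker (proj₁-injective ≡-irrelevant e)) (λ i → proj₂ (elem ker i))

    tr∈Sub : ∀ x → InSub Q (tr x)
    tr∈Sub x = +-cancelʳ x _ _ (trans (trace-^ 0<Q frob (suc s) x)
      (cong (tr x +_) (trans (cong (x ^_) (sym n≡)) (fermat x))))

    preimage? : ∀ w → Dec (∃ λ x → tr x ≡ w)
    preimage? w = search size (λ x → tr x ≟ w) (λ { refl p → p })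

    preimage : Carrier → Carrier
    preimage w with preimage? w
    ... | yes (x , _) = x
    -- A default that is never reached, as `preimage` is applied to values of `tr` alone.
    ... | no  _       = 0#

    tr-preimage : ∀ x → tr (preimage (tr x)) ≡ tr x
    tr-preimage x with preimage? (tr x)
    ... | yes (_ , p) = p
    ... | no  ¬p      = contradiction (x , refl) ¬p

    tr-difference : ∀ x → tr (x + - preimage (tr x)) ≡ 0#
    tr-difference x = +-cancelʳ (tr x) _ _ (begin
      tr (x + - y) + tr x   ≡⟨ cong (tr (x + - y) +_) (sym (tr-preimage x)) ⟩
      tr (x + - y) + tr y   ≡⟨ sym (trace-+ 0<Q frob (suc s) (x + - y) y) ⟩
      tr (x + - y + y)      ≡⟨ cong tr (x-y+y≡x x y) ⟩
      tr x                  ≡⟨ sym (+-identityˡ (tr x)) ⟩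
      0# + tr x             ∎)
      where
      open ≡-Reasoning
      y = preimage (tr x)

    n≤m*k : n ≤ m ℕ.* k
    -- An element is determined by its trace together with its difference from the chosen preimage
    -- of that trace, which lies in the kernel.
    n≤m*k = size-≤ size (size-× sub ker)
      (λ x → (tr x , tr∈Sub x) , (x + - preimage (tr x) , tr-difference x))
      (λ x y e → x-a≡y-a⇒x≡y (trans (cong (λ p → proj₁ (proj₂ p)) e)
        (cong (λ p → y + - preimage (proj₁ (proj₁ p))) (sym e))))
      where
      x-a≡y-a⇒x≡y : ∀ {x y a} → x + - a ≡ y + - a → x ≡ y
      x-a≡y-a⇒x≡y {a = a} = +-cancelʳ (- a) _ _

    instance
      Q^s≢0 : ℕ.NonZero (Q ℕ.^ s)
      Q^s≢0 = ℕₚ.m^n≢0 Q s {{ℕ.>-nonZero 0<Q}}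

    Q≤m : Q ≤ m
    -- Here Q * Q^s = n is at most m * k, hence at most m * Q^s, and Q^s cancels.
    Q≤m = ℕₚ.*-cancelʳ-≤ Q m (Q ℕ.^ s)
      (subst (_≤ m ℕ.* Q ℕ.^ s) n≡ (ℕₚ.≤-trans n≤m*k (ℕₚ.*-monoʳ-≤ m k≤)))

-- Dimension and rank over the subfield of order q

-- This is how comparisons of cardinalities become comparisons of dimensions and ranks.
^-cancelʳ-≤ : ∀ {q} → 1 < q → ∀ {a b} → q ℕ.^ a ≤ q ℕ.^ b → a ≤ b
^-cancelʳ-≤ {q} 1<q le = ℕₚ.≮⇒≥ (λ b<a → ℕₚ.<⇒≱ (ℕₚ.^-monoʳ-< q 1<q b<a) le)

module LinearAlgebra {F : Field} {n} (size : Size {Field.Carrier F} _≡_ n)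
  (q : ℕ) (1<q : 1 < q) (frob : FieldTheory.Frobenius F q)
  (size-q : Size {FF.Sub F q} _≡_ q) where

  open Subfields {F} size public

  private
    0<q : 0 < q
    0<q = ℕₚ.<⇒≤ 1<q

  module Dimension (D : Set) where

    open Lin q D public

    -- `HasDim` only asks for a spanning independent family inside `S`. Closure puts every linear
    -- combination back into `S`, so that none is missing from the count.
    record Subspace (S : V → Set) : Set where
      field
        zero∈ : S (λ _ → 0#)
        comb∈ : ∀ (c : Sub q) {φ ψ} → S φ → S ψ → S (λ x → proj₁ c * φ x + ψ x)

    open Subspace

    lincomb∈ : ∀ {S : V → Set} {r} → Subspace S → (c : Fin r → Sub q) {v : Fin r → V} → (∀ i → S (v i)) → S (lincomb c v)
    lincomb∈ {r = zero}  sub c v∈ = zero∈ sub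
    lincomb∈ {r = suc r} sub c v∈ =
      comb∈ sub (c Fin.zero) (v∈ Fin.zero) (lincomb∈ sub (λ i → c (Fin.suc i)) (λ i → v∈ (Fin.suc i)))

    lincomb-cong : ∀ {r} {c c′ : Fin r → Sub q} (v : Fin r → V) → (∀ i → c i ≡ c′ i) → lincomb c v ≈ lincomb c′ v
    lincomb-cong {zero}  v e x = refl
    lincomb-cong {suc r} v e x = cong₂ _+_ (cong (λ a → proj₁ a * v Fin.zero x) (e Fin.zero))
      (lincomb-cong (λ i → v (Fin.suc i)) (λ i → e (Fin.suc i)) x)

    scale : ∀ {r} → Sub q → (Fin r → Sub q) → Fin r → Sub q
    scale a c i = proj₁ a * proj₁ (c i) , *∈Sub 0<q frob (proj₂ a) (proj₂ (c i))

    lincomb-scale : ∀ {r} (a : Sub q) (c : Fin r → Sub q) (v : Fin r → V) x →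
      lincomb (scale a c) v x ≡ proj₁ a * lincomb c v x
    lincomb-scale {zero}  a c v x = sym (zeroʳ _)
    lincomb-scale {suc r} a c v x = trans
      (cong₂ _+_ (*-assoc _ _ _) (lincomb-scale a (λ i → c (Fin.suc i)) (λ i → v (Fin.suc i)) x))
      (sym (distribˡ _ _ _))

    _⊖_ : ∀ {r} → (Fin r → Sub q) → (Fin r → Sub q) → Fin r → Sub q
    (c ⊖ c′) i = proj₁ (c i) + - proj₁ (c′ i) , +∈Sub 0<q frob (proj₂ (c i)) (-∈Sub 0<q frob (proj₂ (c′ i)))

    lincomb-⊖ : ∀ {r} (c c′ : Fin r → Sub q) (v : Fin r → V) x →
      lincomb (c ⊖ c′) v x + lincomb c′ v x ≡ lincomb c v x
    lincomb-⊖ {zero}  c c′ v x = +-identityʳ 0#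
    lincomb-⊖ {suc r} c c′ v x = trans
      (solve 5 (λ a b w l m → a :* w :+ l :+ (b :* w :+ m) := (a :+ b) :* w :+ (l :+ m)) refl _ _ _ _ _)
      (cong₂ _+_ (cong (_* v Fin.zero x) (x-y+y≡x (proj₁ (c Fin.zero)) (proj₁ (c′ Fin.zero))))
        (lincomb-⊖ (λ i → c (Fin.suc i)) (λ i → c′ (Fin.suc i)) (λ i → v (Fin.suc i)) x))

    -- Coordinates in a basis are unique, since a difference of two coordinate vectors gives a
    -- vanishing combination, and each of the r coordinates has q values.
    hasDim⇒size : ∀ {S : V → Set} {r} → Subspace S → HasDim S r →
                  Size {Σ V S} (λ φ ψ → proj₁ φ ≈ proj₁ ψ) (q ℕ.^ r)
    hasDim⇒size {S} {r} sub (v , v∈ , indep , spans) = record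
      { index           = λ (φ , φ∈) → index coords (proj₁ (spans φ φ∈))
      ; elem            = λ k → lincomb (elem coords k) v , lincomb∈ sub (elem coords k) v∈
      ; index-cong      = λ { {φ , φ∈} {ψ , ψ∈} e → index-cong coords (unique _ _ (λ x →
          trans (sym (proj₂ (spans φ φ∈) x)) (trans (e x) (proj₂ (spans ψ ψ∈) x)))) }
      ; index-injective = λ { {φ , φ∈} {ψ , ψ∈} e x → trans (proj₂ (spans φ φ∈) x)
          (trans (lincomb-cong v (index-injective coords e) x) (sym (proj₂ (spans ψ ψ∈) x))) }
      ; index-elem      = λ k → trans
          (index-cong coords (unique _ (elem coords k) (λ x → sym (proj₂ (spans _ (lincomb∈ sub (elem coords k) v∈)) x))))
          (index-elem coords k)
      }
      where
      coords : Size {Fin r → Sub q} (λ f g → ∀ i → f i ≡ g i) (q ℕ.^ r)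
      coords = size-→ r size-q
      unique : ∀ c c′ → lincomb c v ≈ lincomb c′ v → ∀ i → c i ≡ c′ i
      unique c c′ e i = Sub-≡ {q} (x-y≡0⇒x≡y _ _ (indep (c ⊖ c′) (λ x →
        +-cancelʳ (lincomb c′ v x) _ _ (trans (lincomb-⊖ c c′ v x) (trans (e x) (sym (+-identityˡ _))))) i))

    module _ {d} (size-D : Size {D} _≡_ d) where

      _≈?_ : ∀ φ ψ → Dec (φ ≈ ψ)
      φ ≈? ψ = map′ (λ e x → subst (λ y → φ y ≡ ψ y) (elem-index size-D x) (e (index size-D x)))
                    (λ e i → e (elem size-D i))
                    (Finₚ.all? (λ i → φ (elem size-D i) ≟ ψ (elem size-D i)))

      inSpan? : ∀ {r} (v : Fin r → V) φ → Dec (∃ λ c → φ ≈ lincomb c v)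
      inSpan? {r} v φ = search (size-→ r size-q) (λ c → φ ≈? lincomb c v)
        (λ e φ≈ x → trans (φ≈ x) (lincomb-cong v e x))

      -- A nonzero coefficient at the new vector could be divided out, which would place that vector
      -- in the span of the old ones.
      independent-∷ : ∀ {r} {v : Fin r → V} {φ} → LinIndep v → ¬ (∃ λ c → φ ≈ lincomb c v) → LinIndep (φ ∷ v)
      independent-∷ {r} {v} {φ} indep φ∉ c e = λ { Fin.zero → c₀≡0 ; (Fin.suc i) → indep c′ tail≡0 i }
        where
        c₀ = proj₁ (c Fin.zero)
        c′ : Fin r → Sub q
        c′ i = c (Fin.suc i)
        in-span : ¬ c₀ ≡ 0# → ∃ λ b → φ ≈ lincomb b v
        in-span c₀≢0 = scale a c′ , λ x → *-cancelˡ c₀≢0 (begin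
          c₀ * φ x                            ≡⟨ inverseˡ-unique _ _ (e x) ⟩
          - lincomb c′ v x                    ≡⟨ cong -_ (sym (*-identityˡ _)) ⟩
          - (1# * lincomb c′ v x)             ≡⟨ cong (λ z → - (z * lincomb c′ v x)) (sym (⁻¹-inverse c₀ c₀≢0)) ⟩
          - (c₀ * c₀ ⁻¹ * lincomb c′ v x)     ≡⟨ cong -_ (*-assoc _ _ _) ⟩
          - (c₀ * (c₀ ⁻¹ * lincomb c′ v x))   ≡⟨ -‿distribʳ-* _ _ ⟩
          c₀ * - (c₀ ⁻¹ * lincomb c′ v x)     ≡⟨ cong (c₀ *_) (-‿distribˡ-* _ _) ⟩
          c₀ * (- (c₀ ⁻¹) * lincomb c′ v x)   ≡⟨ cong (c₀ *_) (sym (lincomb-scale a c′ v x)) ⟩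
          c₀ * lincomb (scale a c′) v x                  ∎)
          where
          open ≡-Reasoning
          a : Sub q
          a = - (c₀ ⁻¹) , -∈Sub 0<q frob (⁻¹∈Sub 0<q frob c₀≢0 (proj₂ (c Fin.zero)))
        c₀≡0 : c₀ ≡ 0#
        c₀≡0 = decidable-stable (c₀ ≟ 0#) (λ c₀≢0 → φ∉ (in-span c₀≢0))
        tail≡0 : lincomb c′ v ≈ (λ _ → 0#)
        tail≡0 x = trans (sym (trans (cong (λ z → z * φ x + lincomb c′ v x) c₀≡0)
          (trans (cong (_+ lincomb c′ v x) (zeroˡ _)) (+-identityˡ _)))) (e x)

      -- Greedy choice: a generator is kept only when it is not in the span of those already kept.
      -- Membership in a span is decided by trying all coefficient vectors.
      basis : ∀ {S : V → Set} k (g : Fin k → V) → (∀ j → S (g j)) → ∃ λ r → Σ (Fin r → V) λ v →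
              (∀ i → S (v i)) × LinIndep v × (∀ j → ∃ λ c → g j ≈ lincomb c v)
      basis zero    g g∈ = 0 , (λ ()) , (λ ()) , (λ c _ ()) , λ ()
      basis {S} (suc k) g g∈ with basis {S} k (λ j → g (Fin.suc j)) (λ j → g∈ (Fin.suc j))
      ... | r , v , v∈ , indep , spans with inSpan? v (g Fin.zero)
      ... | yes g₀∈ = r , v , v∈ , indep , λ { Fin.zero → g₀∈ ; (Fin.suc j) → spans j }
      ... | no g₀∉ = suc r , (g Fin.zero ∷ v) , (λ { Fin.zero → g∈ Fin.zero ; (Fin.suc i) → v∈ i })
        , independent-∷ indep g₀∉ , λ
          { Fin.zero → ((1# , 1∈Sub 0<q frob) ∷ λ _ → 0# , 0∈Sub 0<q frob) , λ x →
              sym (trans (cong₂ _+_ (*-identityˡ _) (lincomb-0 v x)) (+-identityʳ _))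
          ; (Fin.suc j) → ((0# , 0∈Sub 0<q frob) ∷ proj₁ (spans j)) , λ x →
              trans (proj₂ (spans j) x) (sym (trans (cong (_+ lincomb (proj₁ (spans j)) v x) (zeroˡ _)) (+-identityˡ _))) }
        where
        lincomb-0 : ∀ {r} (v : Fin r → V) x → lincomb (λ _ → 0# , 0∈Sub 0<q frob) v x ≡ 0#
        lincomb-0 {zero}  v x = refl
        lincomb-0 {suc r} v x = trans (cong₂ _+_ (zeroˡ _) (lincomb-0 (λ i → v (Fin.suc i)) x)) (+-identityʳ 0#)

      -- This serves both images of maps, listed by their domain and possibly with repetitions, and
      -- codes, listed by their coefficients.
      module Parametrised {P : Set} {k} (size-P : Size {P} _≡_ k) {S : V → Set} (sub : Subspace S)
        (g : P → V) (g∈ : ∀ p → S (g p)) (onto : ∀ φ → S φ → ∃ λ p → φ ≈ g p) where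

        hasDim : ∃ λ r → HasDim S r
        hasDim with basis {S} k (λ j → g (elem size-P j)) (λ j → g∈ _)
        ... | r , v , v∈ , indep , spans = r , v , v∈ , indep , λ φ φ∈ → spanned φ (onto φ φ∈)
          where
          spanned : ∀ φ → (∃ λ p → φ ≈ g p) → ∃ λ c → φ ≈ lincomb c v
          spanned φ (p , φ≈) with spans (index size-P p)
          ... | c , g≈ = c , λ x → trans (φ≈ x)
            (trans (cong (λ p′ → g p′ x) (sym (elem-index size-P p))) (g≈ x))

        hasDim⇒≤ : ∀ {r} → HasDim S r → q ℕ.^ r ≤ k
        hasDim⇒≤ dim = size-≤ (hasDim⇒size sub dim) size-P (λ (φ , φ∈) → proj₁ (onto φ φ∈))
          (λ (φ , φ∈) (ψ , ψ∈) e x → trans (proj₂ (onto φ φ∈) x)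
            (trans (cong (λ p → g p x) e) (sym (proj₂ (onto ψ ψ∈) x))))

        -- No explicit basis is needed: some dimension exists, and counting in both directions
        -- forces it to be r.
        hasDim-injective : ∀ r → k ≡ q ℕ.^ r → (∀ p p′ → g p ≈ g p′ → p ≡ p′) → HasDim S r
        hasDim-injective r k≡ g-inj with hasDim
        ... | r′ , dim = subst (HasDim S) (ℕₚ.≤-antisym
          (^-cancelʳ-≤ 1<q (subst (q ℕ.^ r′ ≤_) k≡ (hasDim⇒≤ dim)))
          (^-cancelʳ-≤ 1<q (subst (_≤ q ℕ.^ r′) k≡
            (size-≤ size-P (hasDim⇒size sub dim) (λ p → g p , g∈ p) g-inj)))) dim

  -- Rank by counting images and kernels

  -- The domain is the subfield of order q^t in (a) and the whole field in (b); this is the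
  -- structure that the counting uses in both.
  record Space (D : Set) : Set where
    field
      0D          : D
      comb        : Sub q → D → D → D
      comb-cancel : ∀ c x {y z} → comb c x y ≡ comb c x z → y ≡ z

  module Rank {D : Set} (space : Space D) {d} (size-D : Size {D} _≡_ d) where

    open Space space

    Linear : (D → Carrier) → Set
    Linear φ = φ 0D ≡ 0# × (∀ c x y → φ (comb c x y) ≡ proj₁ c * φ x + φ y)

    module _ {φ : D → Carrier} (linear : Linear φ) where

      private
        module I = Dimension ⊤

        Image : (⊤ → Carrier) → Set
        Image w = ∃ λ x → φ x ≡ w tt

        image-subspace : I.Subspace Image
        image-subspace = record
          { zero∈ = 0D , proj₁ linear
          ; comb∈ = λ c (x , ex) (y , ey) → comb c x y ,
              trans (proj₂ linear c x y) (cong₂ _+_ (cong (proj₁ c *_) ex) ey)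
          }

        size-⊤ : Size {⊤} _≡_ 1
        size-⊤ = record { index = λ _ → Fin.zero ; elem = λ _ → tt ; index-cong = λ _ → refl
                        ; index-injective = λ _ → refl ; index-elem = λ { Fin.zero → refl } }

      abstract
        hasRank : ∃ λ r → HasRank q φ r
        hasRank = I.Parametrised.hasDim size-⊤ size-D image-subspace
          (λ x _ → φ x) (λ x → x , refl) (λ w (x , e) → x , λ _ → sym e)

      module _ {r} (rank : HasRank q φ r) where

        private
          image : Size (λ w w′ → proj₁ w I.≈ proj₁ w′) (q ℕ.^ r)
          image = I.hasDim⇒size image-subspace rank

          section : Fin (q ℕ.^ r) → D
          section i = proj₁ (proj₂ (elem image i))

          φ-section : ∀ i → φ (section i) ≡ proj₁ (elem image i) tt
          φ-section i = proj₂ (proj₂ (elem image i))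

        value : D → Fin (q ℕ.^ r)
        value x = index image ((λ _ → φ x) , x , refl)

        value-injective : ∀ {x y} → value x ≡ value y → φ x ≡ φ y
        value-injective e = index-injective image e tt

        module _ {B : Set} {b} (size-B : Size {B} _≡_ b) where

          -- An element is recovered from its value and from its difference with the chosen preimage
          -- of that value, which is in the kernel. A small kernel thus bounds the rank from below.
          kernel-embeds⇒ : (h : ∀ x → φ x ≡ 0# → B) → (∀ x y p p′ → h x p ≡ h y p′ → x ≡ y) → d ≤ q ℕ.^ r ℕ.* b
          kernel-embeds⇒ h h-inj = size-≤ size-D (size-× (size-Fin _) size-B)
            (λ x → value x , h (reduced x) (reduced∈ker x)) injective
            where
            -1q : Sub q
            -1q = - 1# , -∈Sub 0<q frob (1∈Sub 0<q frob)
            reduced : D → D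
            reduced x = comb -1q (section (value x)) x
            reduced∈ker : ∀ x → φ (reduced x) ≡ 0#
            reduced∈ker x = begin
              φ (reduced x)                            ≡⟨ proj₂ linear _ _ _ ⟩
              - 1# * φ (section (value x)) + φ x       ≡⟨ cong (λ z → - 1# * z + φ x)
                                                            (trans (φ-section (value x)) (elem-index image _ tt)) ⟩
              - 1# * φ x + φ x                         ≡⟨ cong (_+ φ x) (-1*x≈-x (φ x)) ⟩
              - φ x + φ x                              ≡⟨ -‿inverseˡ (φ x) ⟩
              0#                                       ∎
              where open ≡-Reasoning
            injective : ∀ x y → (value x , h (reduced x) (reduced∈ker x)) ≡ (value y , h (reduced y) (reduced∈ker y)) → x ≡ y
            injective x y e = comb-cancel -1q (section (value x))
              (trans (h-inj _ _ _ _ (cong proj₂ e)) (cong (λ i → comb -1q (section i) y) (sym (cong proj₁ e))))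

          -- Sums of a chosen preimage and a kernel element are pairwise distinct: the value reveals
          -- the first summand. Many kernel elements thus bound the rank from above.
          embeds-in-kernel⇒ : (h : B → D) → (∀ b → φ (h b) ≡ 0#) → (∀ b b′ → h b ≡ h b′ → b ≡ b′) → q ℕ.^ r ℕ.* b ≤ d
          embeds-in-kernel⇒ h h∈ker h-inj = size-≤ (size-× (size-Fin _) size-B) size-D point injective
            where
            1q : Sub q
            1q = 1# , 1∈Sub 0<q frob
            point : Fin (q ℕ.^ r) × B → D
            point (i , b) = comb 1q (section i) (h b)
            φ-point : ∀ i b → φ (point (i , b)) ≡ proj₁ (elem image i) tt
            φ-point i b = trans (proj₂ linear _ _ _) (trans (cong₂ _+_ (*-identityˡ _) (h∈ker b))
              (trans (+-identityʳ _) (φ-section i)))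
            injective : ∀ u v → point u ≡ point v → u ≡ v
            injective (i , b) (j , b′) e with elem-injective image {i} {j}
              (λ _ → trans (sym (φ-point i b)) (trans (cong φ e) (φ-point j b′)))
            ... | refl = cong (i ,_) (h-inj _ _ (comb-cancel 1q (section i) e))

-- The extension of degree t(s + 1) over the field of order q, and part (a)

primePower>1 : ∀ {q} → IsPrimePower q → 1 < q
primePower>1 (p , e , pr , refl) = ℕₚ.≤-trans 1<p (ℕₚ.≤-trans (ℕₚ.≤-reflexive (sym (ℕₚ.*-identityʳ p)))
  (ℕₚ.*-monoʳ-≤ p (ℕₚ.m^n>0 p {{ℕ.>-nonZero (ℕₚ.<⇒≤ 1<p)}} e)))
  where
  1<p : 1 < p
  1<p = ℕ.nonTrivial⇒n>1 p {{prime⇒nonTrivial pr}}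

primePower-frobenius : ∀ {F : Field} {q N} → IsPrimePower q → Size {Field.Carrier F} _≡_ (q ℕ.^ N) →
                       FieldTheory.Frobenius F q
primePower-frobenius {F} {N = N} (p , e , pr , refl) size = frobenius-^ {p} (freshman pr
    (Finite.p^k≡n⇒p×1≡0 size p (suc e ℕ.* N) (sym (ℕₚ.^-*-assoc p (suc e) N)))) (suc e)
  where open FieldTheory F

0<*suc : ∀ {t} s → 1 < t → 0 < t ℕ.* suc s
0<*suc {suc t} s _ = s≤s z≤n

module Extension {F : Field} {q t s : ℕ} (pp : IsPrimePower q) (1<t : 1 < t)
  (size : Size {Field.Carrier F} _≡_ (q ℕ.^ (t ℕ.* suc s))) where

  N : ℕ
  N = t ℕ.* suc s

  Q : ℕ
  Q = q ℕ.^ t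

  1<q : 1 < q
  1<q = primePower>1 pp

  frobenius-q : FieldTheory.Frobenius F q
  frobenius-q = primePower-frobenius {F} {N = N} pp size

  abstract
    size-q : Size {FF.Sub F q} _≡_ q
    -- `subfield-size` takes the extension degree less one: that degree is `N` over the field of
    -- order q, and `suc s` over the field of order `Q` below.
    size-q = Subfields.subfield-size size (ℕ.pred N) 1<q frobenius-q
      (cong (q ℕ.^_) (sym (ℕₚ.suc-pred N {{ℕ.>-nonZero (0<*suc s 1<t)}})))

  open LinearAlgebra {F} size q 1<q frobenius-q size-q public

  0<q : 0 < q
  0<q = ℕₚ.<⇒≤ 1<q

  frobenius-Q : Frobenius Q
  frobenius-Q = frobenius-^ frobenius-q t

  q<Q : q < Q
  q<Q = subst (_< Q) (ℕₚ.*-identityʳ q) (ℕₚ.^-monoʳ-< q 1<q 1<t)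

  0<Q : 0 < Q
  0<Q = ℕₚ.<-trans 0<q q<Q

  abstract
    size-Q : Size {Sub Q} _≡_ Q
    size-Q = subfield-size s (ℕₚ.<-trans 1<q q<Q) frobenius-Q (sym (ℕₚ.^-*-assoc q t (suc s)))

  InSub-^ : ∀ {P} e {x} → InSub P x → InSub (P ℕ.^ e) x
  InSub-^ zero    {x} p = *-identityʳ x
  InSub-^ {P} (suc e) {x} p = trans (^-* x P (P ℕ.^ e)) (trans (cong (_^ (P ℕ.^ e)) p) (InSub-^ e p))

  F-space : Space Carrier
  F-space = record { 0D = 0# ; comb = λ c x y → proj₁ c * x + y ; comb-cancel = λ c x → +-cancelˡ _ _ _ }

  FQ-space : Space (Sub Q)
  FQ-space = record
    { 0D          = 0# , 0∈Sub 0<Q frobenius-Q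
    ; comb        = λ (c , c∈) (x , x∈) (y , y∈) → c * x + y ,
        +∈Sub 0<Q frobenius-Q (*∈Sub 0<Q frobenius-Q (InSub-^ t c∈) x∈) y∈
    ; comb-cancel = λ c x e → Sub-≡ {Q} (+-cancelˡ _ _ _ (cong proj₁ e))
    }

  Fq-linear : (Carrier → Carrier) → Set
  Fq-linear f = ∀ c x y → InSub q c → f (c * x + y) ≡ c * f x + f y

  ^q^-linear : ∀ i → Fq-linear (_^ (q ℕ.^ i))
  ^q^-linear i c x y c∈ = trans (frobenius-^ frobenius-q i (c * x) y)
    (cong (_+ _) (trans (^-distrib-* c x (q ℕ.^ i)) (cong (_* _) (InSub-^ i c∈))))

  scale-linear : ∀ {f} a → Fq-linear f → Fq-linear (λ x → a * f x)
  scale-linear {f} a lin c x y c∈ = trans (cong (a *_) (lin c x y c∈))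
    (solve 4 (λ a c u v → a :* (c :* u :+ v) := c :* (a :* u) :+ a :* v) refl a c (f x) (f y))

  +-linear : ∀ {f g} → Fq-linear f → Fq-linear g → Fq-linear (λ x → f x + g x)
  +-linear {f} {g} lin lin′ c x y c∈ = trans (cong₂ _+_ (lin c x y c∈) (lin′ c x y c∈))
    (solve 5 (λ c u v w z → (c :* u :+ v) :+ (c :* w :+ z) := c :* (u :+ w) :+ (v :+ z)) refl c (f x) (f y) (g x) (g y))

  sumF-linear : ∀ {m} (g : Fin m → Carrier → Carrier) → (∀ i → Fq-linear (g i)) → Fq-linear (λ x → sumF (λ i → g i x))
  sumF-linear {zero}  g lin c x y c∈ = sym (trans (+-identityʳ _) (zeroʳ c))
  sumF-linear {suc m} g lin = +-linear {g Fin.zero} (lin Fin.zero)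
    (sumF-linear (λ i → g (Fin.suc i)) (λ i → lin (Fin.suc i)))

  qpoly-linear : ∀ {m} (a : Fin m → Carrier) → Fq-linear (qpoly q a)
  qpoly-linear a = sumF-linear _ (λ i → scale-linear (a i) (^q^-linear (Fin.toℕ i)))

  linear-0 : ∀ {f} → Fq-linear f → f 0# ≡ 0#
  linear-0 {f} lin = +-cancelˡ (f 0#) _ _ (sym (begin
    f 0# + 0#            ≡⟨ +-identityʳ _ ⟩
    f 0#                 ≡⟨ cong f (sym (solve 0 (con 1 :* con 0 :+ con 0 := con 0) refl)) ⟩
    f (1# * 0# + 0#)     ≡⟨ lin 1# 0# 0# (1^ q) ⟩
    1# * f 0# + f 0#     ≡⟨ cong (_+ f 0#) (*-identityˡ _) ⟩
    f 0# + f 0#          ∎))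
    where open ≡-Reasoning

  /-unique : ∀ {x y z} → ¬ y ≡ 0# → z * y ≡ x → x * y ⁻¹ ≡ z
  /-unique y≢0 refl = trans (*-assoc _ _ _) (trans (cong (_ *_) (⁻¹-inverse _ y≢0)) (*-identityʳ _))

  cross-multiply : ∀ {x y u v} → ¬ y ≡ 0# → ¬ v ≡ 0# → x * v ≡ u * y → x * y ⁻¹ ≡ u * v ⁻¹
  cross-multiply {x} {y} {u} {v} y≢0 v≢0 e = /-unique y≢0 (*-cancelʳ v≢0 (begin
    u * v ⁻¹ * y * v     ≡⟨ solve 4 (λ u i y v → u :* i :* y :* v := u :* i :* v :* y) refl u (v ⁻¹) y v ⟩
    u * v ⁻¹ * v * y     ≡⟨ cong (_* y) (x*y⁻¹*y≡x u v≢0) ⟩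
    u * y                ≡⟨ sym e ⟩
    x * v                ∎))
    where open ≡-Reasoning

  -- Otherwise μ = (c - a) / (b - d) would be a quotient of elements of the subfield.
  independent : ∀ {P} → 0 < P → Frobenius P → ∀ {μ a b c d} → ¬ InSub P μ →
                InSub P a → InSub P b → InSub P c → InSub P d →
                a + b * μ ≡ c + d * μ → a ≡ c × b ≡ d
  independent {P} 0<P frob {μ} {a} {b} {c} {d} μ∉ a∈ b∈ c∈ d∈ e = +-cancelʳ (b * μ) _ _
      (trans e (cong (λ z → c + z * μ) (sym b≡d))) , b≡d
    where
    open ≡-Reasoning
    μ-value : (b + - d) * μ ≡ c + - a
    μ-value = +-cancelˡ (a + d * μ) _ _ (begin
      a + d * μ + (b + - d) * μ
        ≡⟨ solve 5 (λ a d μ b n → a :+ d :* μ :+ (b :+ n) :* μ := a :+ b :* μ :+ (n :+ d) :* μ) refl a d μ b (- d) ⟩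
      a + b * μ + (- d + d) * μ    ≡⟨ cong₂ (λ u v → u + v * μ) e (-‿inverseˡ d) ⟩
      c + d * μ + 0# * μ
        ≡⟨ solve 3 (λ c d μ → c :+ d :* μ :+ con 0 :* μ := c :+ d :* μ :+ con 0) refl c d μ ⟩
      c + d * μ + 0#               ≡⟨ cong (c + d * μ +_) (sym (-‿inverseˡ a)) ⟩
      c + d * μ + (- a + a)
        ≡⟨ solve 5 (λ c d μ n a → c :+ d :* μ :+ (n :+ a) := a :+ d :* μ :+ (c :+ n)) refl c d μ (- a) a ⟩
      a + d * μ + (c + - a)        ∎)
    b≡d : b ≡ d
    b≡d = decidable-stable (b ≟ d) λ b≢d →
      let b-d≢0 : ¬ (b + - d ≡ 0#)
          b-d≢0 = λ z → b≢d (x-y≡0⇒x≡y _ _ z)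
      in μ∉ (subst (InSub P) (/-unique b-d≢0 (trans (*-comm μ _) μ-value))
           (*∈Sub 0<P frob (+∈Sub 0<P frob c∈ (-∈Sub 0<P frob a∈))
             (⁻¹∈Sub 0<P frob b-d≢0 (+∈Sub 0<P frob b∈ (-∈Sub 0<P frob d∈)))))

  -- Dividing by one fixed nonzero kernel element sends the kernel injectively into `Sub P`, so the
  -- kernel has at most P elements. In (a) P is q; in (b), for α = 0, it is `Q`.
  module RatioEmbedding {D : Set} {d} (size-D : Size {D} _≡_ d) (ι : D → Carrier) (ι-inj : ∀ {x y} → ι x ≡ ι y → x ≡ y)
    {P} (0<P : 0 < P) (φ : D → Carrier)
    (ratio : ∀ x y → φ x ≡ 0# → φ y ≡ 0# → ¬ ι x ≡ 0# → ¬ ι y ≡ 0# → InSub P (ι x * ι y ⁻¹)) where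

    kernel-embedding : Σ (∀ x → φ x ≡ 0# → Sub P) λ h → ∀ x y p p′ → h x p ≡ h y p′ → x ≡ y
    kernel-embedding with search size-D (λ x → (φ x ≟ 0#) ×-dec ¬? (ι x ≟ 0#)) (λ { refl p → p })
    -- The kernel is trivial here, so a constant map embeds it.
    ... | no none = (λ _ _ → 0# , 0^ P 0<P) , λ x y p p′ _ → ι-inj (trans (trivial x p) (sym (trivial y p′)))
      where
      trivial : ∀ x → φ x ≡ 0# → ι x ≡ 0#
      trivial x p = decidable-stable (ι x ≟ 0#) (λ ιx≢0 → none (x , p , ιx≢0))
    ... | yes (y , φy≡0 , ιy≢0) = (λ x p → ι x * ι y ⁻¹ , ratio∈ x p) ,
        λ x x′ _ _ e → ι-inj (*-cancelʳ (x⁻¹≢0 ιy≢0) (cong proj₁ e))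
      where
      ratio∈ : ∀ x → φ x ≡ 0# → InSub P (ι x * ι y ⁻¹)
      ratio∈ x p with ι x ≟ 0#
      ... | yes ιx≡0 = subst (InSub P) (sym (trans (cong (_* ι y ⁻¹) ιx≡0) (zeroˡ _))) (0^ P 0<P)
      ... | no ιx≢0  = ratio x y p φy≡0 ιx≢0 ιy≢0

    -- The kernel of a zero map would be all of `D`, too large to embed in `Sub P`.
    nonzero : Size {Sub P} _≡_ P → P < d → ¬ (∀ x → φ x ≡ 0#)
    nonzero size-P P<d φ≡0 = ℕₚ.<⇒≱ P<d (size-≤ size-D size-P (λ x → proj₁ kernel-embedding x (φ≡0 x))
      (λ x y → proj₂ kernel-embedding x y (φ≡0 x) (φ≡0 y)))

  -- Part (a): codes of maps on the subfield of order q^t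

  module RestrictedCodes {m} (a : Fin m → Carrier) (k : ℕ) where

    f : Carrier → Carrier
    f = qpoly q a

    f-linear : Fq-linear f
    f-linear = qpoly-linear a

    -- The exponent q^(kt) is the k-th power of `Q`, and raising to the power `Q` fixes every
    -- element of `Sub Q`.
    ^q^kt : (x : Sub Q) → proj₁ x ^ (q ℕ.^ (k ℕ.* t)) ≡ proj₁ x
    ^q^kt (x , x∈) = trans (cong (x ^_) (trans (cong (q ℕ.^_) (ℕₚ.*-comm k t)) (sym (ℕₚ.^-*-assoc q t k)))) (InSub-^ k x∈)

    open Dimension (Sub Q)
    open Rank FQ-space size-Q

    N*2≰N : ¬ N ℕ.* 2 ≤ N
    N*2≰N le = ℕₚ.<⇒≱ (ℕₚ.m<m*n N 2 {{ℕ.>-nonZero (0<*suc s 1<t)}} (s≤s (s≤s z≤n))) le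

    MRD-dimension : (N ℕ.⊔ t) ℕ.* suc ((N ℕ.⊓ t) ℕ.∸ (t ℕ.∸ 1)) ≡ N ℕ.* 2
    MRD-dimension = cong₂ (λ u v → u ℕ.* suc v) (ℕₚ.m≥n⇒m⊔n≡m t≤N)
      (trans (cong (ℕ._∸ (t ℕ.∸ 1)) (ℕₚ.m≥n⇒m⊓n≡n t≤N)) (ℕₚ.m∸[m∸n]≡n (ℕₚ.<⇒≤ 1<t)))
      where
      t≤N : t ≤ N
      t≤N = ℕₚ.m≤m*n t (suc s)

    module _ (σ : Carrier) where

      Code : V → Set
      Code = Cfσk q t a σ k

      member : Carrier × Carrier → V
      member (α , β) x = α * f (σ * proj₁ x) + β * proj₁ x

      member∈ : ∀ p → Code (member p)
      member∈ (α , β) = α , β , λ x → cong (λ z → _ + β * z) (sym (^q^kt x))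

      onto : ∀ φ → Code φ → ∃ λ p → φ ≈ member p
      onto φ (α , β , e) = (α , β) , λ x → trans (e x) (cong (λ z → _ + β * z) (^q^kt x))

      Code-subspace : Subspace Code
      Code-subspace = record
        { zero∈ = 0# , 0# , λ x → sym (solve 2 (λ u v → con 0 :* u :+ con 0 :* v := con 0) refl _ _)
        ; comb∈ = λ (c , _) (α , β , e) (α′ , β′ , e′) → c * α + α′ , c * β + β′ , λ x →
            trans (cong₂ (λ u v → c * u + v) (e x) (e′ x))
              (solve 7 (λ c α β α′ β′ u v → c :* (α :* u :+ β :* v) :+ (α′ :* u :+ β′ :* v)
                 := (c :* α :+ α′) :* u :+ (c :* β :+ β′) :* v) refl c α β α′ β′ _ _)
        }

      Code-linear : ∀ {φ} → Code φ → Linear φ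
      Code-linear {φ} φ∈ with onto φ φ∈
      ... | (α , β) , e = trans (e (Space.0D FQ-space)) (linear-0 lin)
        , λ c x y → trans (e _) (trans (lin (proj₁ c) (proj₁ x) (proj₁ y) (proj₂ c))
            (sym (cong₂ (λ u v → proj₁ c * u + v) (e x) (e y))))
        where
        lin : Fq-linear (λ z → α * f (σ * z) + β * z)
        lin = +-linear (scale-linear α (λ c x y c∈ → trans
            (cong f (solve 4 (λ σ c x y → σ :* (c :* x :+ y) := c :* (σ :* x) :+ σ :* y) refl σ c x y))
            (f-linear c (σ * x) (σ * y) c∈)))
          (scale-linear β (λ c x y c∈ → refl))

      member-difference : ∀ α β α′ β′ → member (α , β) ≈ member (α′ , β′) → member (α + - α′ , β + - β′) ≈ (λ _ → 0#)
      member-difference α β α′ β′ e x = +-cancelʳ (member (α′ , β′) x) _ _ (begin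
        (α + - α′) * u + (β + - β′) * v + (α′ * u + β′ * v)
          ≡⟨ solve 6 (λ A B α′ β′ u v → A :* u :+ B :* v :+ (α′ :* u :+ β′ :* v)
               := (A :+ α′) :* u :+ (B :+ β′) :* v) refl (α + - α′) (β + - β′) α′ β′ u v ⟩
        (α + - α′ + α′) * u + (β + - β′ + β′) * v
          ≡⟨ cong₂ (λ A B → A * u + B * v) (x-y+y≡x α α′) (x-y+y≡x β β′) ⟩
        α * u + β * v                         ≡⟨ e x ⟩
        α′ * u + β′ * v                       ≡⟨ sym (+-identityˡ _) ⟩
        0# + (α′ * u + β′ * v)                ∎)
        where
        open ≡-Reasoning
        u = f (σ * proj₁ x)
        v = proj₁ x

      module Scattered⇒MRD (ps : PartiallyScattered q t a) (σ≢0 : ¬ σ ≡ 0#) where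

        -- For α = 0 the kernel is trivial; otherwise kernel elements x satisfy f(σx)/σx = -β/ασ.
        ratio : ∀ {α β} → ¬ (α ≡ 0# × β ≡ 0#) → ∀ x y → member (α , β) x ≡ 0# → member (α , β) y ≡ 0# →
                ¬ proj₁ x ≡ 0# → ¬ proj₁ y ≡ 0# → InSub q (proj₁ x * proj₁ y ⁻¹)
        ratio {α} {β} nz (x , x∈) (y , y∈) ex ey x≢0 y≢0 with α ≟ 0#
        ... | yes refl = contradiction (*-cancelʳ x≢0
            (trans (trans (solve 3 (λ β u x → β :* x := con 0 :* u :+ β :* x) refl β _ x) ex) (sym (zeroˡ x))))
            (λ β≡0 → nz (refl , β≡0))
        ... | no α≢0 = subst (InSub q) σ-ratio (ps (σ * x) (σ * y) (x*y≢0 σ≢0 x≢0) (x*y≢0 σ≢0 y≢0)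
            (cross-multiply (x*y≢0 σ≢0 x≢0) (x*y≢0 σ≢0 y≢0) (begin
              f (σ * x) * (σ * y)    ≡⟨ solve 3 (λ u σ y → u :* (σ :* y) := σ :* (u :* y)) refl _ σ y ⟩
              σ * (f (σ * x) * y)    ≡⟨ cong (σ *_) cross ⟩
              σ * (f (σ * y) * x)    ≡⟨ solve 3 (λ u σ y → σ :* (u :* y) := u :* (σ :* y)) refl _ σ x ⟩
              f (σ * y) * (σ * x)    ∎))
            (subst (InSub Q) (sym σ-ratio) (*∈Sub 0<Q frobenius-Q x∈ (⁻¹∈Sub 0<Q frobenius-Q y≢0 y∈))))
          where
          open ≡-Reasoning
          σ-ratio : σ * x * (σ * y) ⁻¹ ≡ x * y ⁻¹
          σ-ratio = cross-multiply (x*y≢0 σ≢0 y≢0) y≢0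
            (solve 3 (λ σ x y → σ :* x :* y := x :* (σ :* y)) refl σ x y)
          cross : f (σ * x) * y ≡ f (σ * y) * x
          -- Multiplying the equation at x by y and the one at y by x gives both the same term in β,
          -- which cancels.
          cross = *-cancelˡ α≢0 (+-cancelʳ (β * x * y) _ _ (begin
            α * (f (σ * x) * y) + β * x * y
              ≡⟨ solve 5 (λ α u y β x → α :* (u :* y) :+ β :* x :* y := (α :* u :+ β :* x) :* y) refl α _ y β x ⟩
            (α * f (σ * x) + β * x) * y     ≡⟨ trans (cong (_* y) ex) (zeroˡ y) ⟩
            0#                              ≡⟨ sym (trans (cong (_* x) ey) (zeroˡ x)) ⟩
            (α * f (σ * y) + β * y) * x
              ≡⟨ solve 5 (λ α u y β x → (α :* u :+ β :* y) :* x := α :* (u :* x) :+ β :* x :* y) refl α _ y β x ⟩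
            α * (f (σ * y) * x) + β * x * y ∎))

        module R {α β} (nz : ¬ (α ≡ 0# × β ≡ 0#)) =
          RatioEmbedding size-Q proj₁ (Sub-≡ {Q}) 0<q (member (α , β)) (ratio nz)

        member≢0 : ∀ {α β} → ¬ (α ≡ 0# × β ≡ 0#) → ¬ (∀ x → member (α , β) x ≡ 0#)
        member≢0 nz = R.nonzero nz size-q q<Q

        -- The kernel has at most q elements, so q^t is at most q^r * q.
        rank≥t-1 : ∀ {α β φ r} → ¬ (α ≡ 0# × β ≡ 0#) → Code φ → φ ≈ member (α , β) → HasRank q φ r → t ℕ.∸ 1 ≤ r
        rank≥t-1 {r = r} nz φ∈ e rank = ℕₚ.∸-monoˡ-≤ {t} {suc r} 1
          (^-cancelʳ-≤ 1<q (subst (Q ≤_) (ℕₚ.*-comm (q ℕ.^ r) q)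
            (kernel-embeds⇒ (Code-linear φ∈) rank size-q
              (λ x p → proj₁ (R.kernel-embedding nz) x (trans (sym (e x)) p))
              (λ x y p p′ → proj₂ (R.kernel-embedding nz) x y (trans (sym (e x)) p) (trans (sym (e y)) p′)))))

        minimum : ∀ φ → Code φ → ¬ (∀ x → φ x ≡ 0#) → ∃ λ r → HasRank q φ r × t ℕ.∸ 1 ≤ r
        minimum φ φ∈ φ≢0 = bound (onto φ φ∈) (hasRank (Code-linear φ∈))
          where
          bound : (∃ λ p → φ ≈ member p) → (∃ λ r → HasRank q φ r) → ∃ λ r → HasRank q φ r × t ℕ.∸ 1 ≤ r
          bound ((α , β) , e) (r , rank) = r , rank , rank≥t-1 nz φ∈ e rank
            where
            nz : ¬ (α ≡ 0# × β ≡ 0#)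
            nz (α≡0 , β≡0) = φ≢0 (λ x → trans (e x) (trans
              (cong₂ (λ u v → u * f (σ * proj₁ x) + v * proj₁ x) α≡0 β≡0)
              (trans (cong₂ _+_ (zeroˡ _) (zeroˡ _)) (+-identityʳ 0#))))

        -- The map f(σx) - f(σ) x vanishes at 1 and hence on all of F_q, so its rank is at most t -
        -- 1, and the lower bound makes this exact.
        attained : ∃ λ φ → Code φ × ¬ (∀ x → φ x ≡ 0#) × HasRank q φ (t ℕ.∸ 1)
        attained = φ , φ∈ , member≢0 nz , subst (HasRank q φ) (ℕₚ.≤-antisym r≤t-1 (rank≥t-1 nz φ∈ (λ _ → refl) rank)) rank
          where
          open Space FQ-space
          φ = member (1# , - f σ)
          φ∈ = member∈ (1# , - f σ)
          nz : ¬ (1# ≡ 0# × - f σ ≡ 0#)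
          nz (1≡0 , _) = 0≢1 (sym 1≡0)
          1Q : Sub Q
          1Q = 1# , 1^ Q
          φ1≡0 : φ 1Q ≡ 0#
          φ1≡0 = trans (cong₂ _+_ (trans (*-identityˡ _) (cong f (*-identityʳ σ))) (*-identityʳ _)) (-‿inverseʳ (f σ))
          r = proj₁ (hasRank (Code-linear φ∈))
          rank = proj₂ (hasRank (Code-linear φ∈))
          r≤t-1 : r ≤ t ℕ.∸ 1
          r≤t-1 = ℕₚ.∸-monoˡ-≤ {suc r} {t} 1 (^-cancelʳ-≤ 1<q (subst (_≤ Q) (ℕₚ.*-comm (q ℕ.^ r) q)
            (embeds-in-kernel⇒ (Code-linear φ∈) rank size-q (λ c → comb c 1Q 0D)
              (λ c → trans (proj₂ (Code-linear φ∈) c 1Q 0D)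
                (trans (cong₂ (λ u v → proj₁ c * u + v) φ1≡0 (proj₁ (Code-linear φ∈))) (trans (+-identityʳ _) (zeroʳ _))))
              (λ c c′ e → Sub-≡ {q} (trans (coefficient c) (trans (cong proj₁ e) (sym (coefficient c′))))))))
            where
            coefficient : ∀ c → proj₁ c ≡ proj₁ (comb c 1Q 0D)
            coefficient c = sym (trans (+-identityʳ _) (*-identityʳ _))

        dimension : HasDim Code (N ℕ.* 2)
        dimension = Parametrised.hasDim-injective size-Q (size-× size size) Code-subspace member member∈ onto (N ℕ.* 2)
          (sym (trans (cong (q ℕ.^_) (ℕₚ.*-comm N 2)) (trans (ℕₚ.^-distribˡ-+-* q N (N ℕ.+ 0))
            (cong (λ z → q ℕ.^ N ℕ.* q ℕ.^ z) (ℕₚ.+-identityʳ N)))))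
          (λ (α , β) (α′ , β′) e → injective α β α′ β′ e)
          where
          injective : ∀ α β α′ β′ → member (α , β) ≈ member (α′ , β′) → (α , β) ≡ (α′ , β′)
          injective α β α′ β′ e = decidable-stable (pair≟ _ _) λ ne →
            member≢0 (λ (u , v) → ne (cong₂ _,_ (x-y≡0⇒x≡y _ _ u) (x-y≡0⇒x≡y _ _ v))) (member-difference α β α′ β′ e)
            where
            pair≟ : (u v : Carrier × Carrier) → Dec (u ≡ v)
            pair≟ = decide (size-× size size)

        isMRD : IsMRD q N t (t ℕ.∸ 1) Code
        isMRD = (minimum , attained) , subst (HasDim Code) (sym MRD-dimension) dimension

      module MRD⇒Scattered (mrd : IsMRD q N t (t ℕ.∸ 1) Code) where

        -- If f(σx) = βx throughout, every member has the form γ x, and q^N values of γ cannot list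
        -- the q^(2N) elements of the code.
        member-zero⇒⊥ : ∀ {β} → ¬ (∀ x → member (1# , - β) x ≡ 0#)
        member-zero⇒⊥ {β} φ≡0 = N*2≰N (^-cancelʳ-≤ 1<q
          (Parametrised.hasDim⇒≤ size-Q size Code-subspace (λ γ x → γ * proj₁ x)
            (λ γ → 0# , γ , λ x → trans (solve 3 (λ γ x u → γ :* x := con 0 :* u :+ γ :* x) refl γ (proj₁ x) (f (σ * proj₁ x)))
              (cong (λ z → 0# * _ + γ * z) (sym (^q^kt x))))
            (λ φ φ∈ → collapse φ (onto φ φ∈))
            (subst (HasDim Code) MRD-dimension (proj₂ mrd))))
          where
          f-value : ∀ (x : Sub Q) → f (σ * proj₁ x) ≡ β * proj₁ x
          f-value x = x-y≡0⇒x≡y _ _ (trans (cong₂ _+_ (sym (*-identityˡ _)) (-‿distribˡ-* β (proj₁ x))) (φ≡0 x))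
          collapse : ∀ φ → (∃ λ p → φ ≈ member p) → ∃ λ γ → φ ≈ (λ x → γ * proj₁ x)
          collapse φ ((α′ , β′) , e) = α′ * β + β′ , λ x → trans (e x) (trans (cong (λ z → α′ * z + _) (f-value x))
            (solve 4 (λ a b c x → a :* (b :* x) :+ c :* x := (a :* b :+ c) :* x) refl α′ β β′ (proj₁ x)))

        -- If μ were outside F_q, the combinations of 1 and μ would be q^2 kernel elements, giving r
        -- + 2 ≤ t against r ≥ t - 1.
        kernel-1-μ⇒μ∈ : ∀ {β} (μ : Sub Q) → member (1# , - β) (1# , 1^ Q) ≡ 0# → member (1# , - β) μ ≡ 0# → InSub q (proj₁ μ)
        kernel-1-μ⇒μ∈ {β} μ φ1≡0 φμ≡0 = decidable-stable (InSub? q (proj₁ μ)) λ μ∉ →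
          let open Space FQ-space
              φ  = member (1# , - β)
              φ∈ = member∈ (1# , - β)
              (φ0≡0 , lin) = Code-linear φ∈
              (r , rank , t-1≤r) = proj₁ (proj₁ mrd) φ φ∈ member-zero⇒⊥
              r+2≤t : r ℕ.+ 2 ≤ t
              r+2≤t = ^-cancelʳ-≤ 1<q (subst (_≤ Q) (sym (trans (ℕₚ.^-distribˡ-+-* q r 2)
                  (cong (λ z → q ℕ.^ r ℕ.* (q ℕ.* z)) (ℕₚ.*-identityʳ q))))
                (embeds-in-kernel⇒ (Code-linear φ∈) rank (size-× size-q size-q)
                  (λ (c , d) → comb c (1# , 1^ Q) (comb d μ 0D))
                  (λ (c , d) → trans (lin c (1# , 1^ Q) (comb d μ 0D)) (trans (cong₂ (λ u v → proj₁ c * u + v) φ1≡0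
                     (trans (lin d μ 0D) (cong₂ (λ u v → proj₁ d * u + v) φμ≡0 φ0≡0)))
                     (solve 2 (λ c d → c :* con 0 :+ (d :* con 0 :+ con 0) := con 0) refl (proj₁ c) (proj₁ d))))
                  (λ (c , d) (c′ , d′) e →
                    let (u , v) = independent 0<q frobenius-q μ∉ (proj₂ c) (proj₂ d) (proj₂ c′) (proj₂ d′)
                          (trans (shape (proj₁ c) (proj₁ d)) (trans (cong proj₁ e) (sym (shape (proj₁ c′) (proj₁ d′)))))
                    in cong₂ _,_ (Sub-≡ {q} u) (Sub-≡ {q} v))))
          in ℕₚ.<⇒≱ (ℕₚ.≤-trans (ℕₚ.≤-reflexive (ℕₚ.+-comm 2 r)) r+2≤t) (ℕₚ.≤-trans (ℕₚ.m≤n+m∸n t 1) (s≤s t-1≤r))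
          where
          shape : ∀ c d → c + d * proj₁ μ ≡ c * 1# + (d * proj₁ μ + 0#)
          shape c d = sym (solve 3 (λ c d μ → c :* con 1 :+ (d :* μ :+ con 0) := c :+ d :* μ) refl c d (proj₁ μ))

    scattered⇔MRD : PartiallyScattered q t a ⇔ (∀ σ → ¬ (σ ≡ 0#) → IsMRD q N t (t ℕ.∸ 1) (Cfσk q t a σ k))
    scattered⇔MRD = mk⇔ (λ ps σ σ≢0 → Scattered⇒MRD.isMRD σ ps σ≢0) scattered
      where
      scattered : (∀ σ → ¬ (σ ≡ 0#) → IsMRD q N t (t ℕ.∸ 1) (Cfσk q t a σ k)) → PartiallyScattered q t a
      scattered mrd y z y≢0 z≢0 e μ∈ = MRD⇒Scattered.kernel-1-μ⇒μ∈ z (mrd z z≢0) {f z} (y * z ⁻¹ , μ∈)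
        (trans (cong₂ _+_ (trans (*-identityˡ _) (cong f (*-identityʳ z))) (*-identityʳ _)) (-‿inverseʳ (f z)))
        (begin
          1# * f (z * (y * z ⁻¹)) + - f z * (y * z ⁻¹)
            ≡⟨ cong₂ _+_ (trans (*-identityˡ _) (cong f (trans (*-comm z _) (x*y⁻¹*y≡x y z≢0)))) (sym (-‿distribˡ-* _ _)) ⟩
          f y + - (f z * (y * z ⁻¹))
            ≡⟨ cong (λ w → f y + - w) (begin
                 f z * (y * z ⁻¹)   ≡⟨ solve 3 (λ a y i → a :* (y :* i) := a :* i :* y) refl (f z) y (z ⁻¹) ⟩
                 f z * z ⁻¹ * y     ≡⟨ cong (_* y) (sym e) ⟩
                 f y * y ⁻¹ * y     ≡⟨ x*y⁻¹*y≡x (f y) y≢0 ⟩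
                 f y                ∎) ⟩
          f y + - f y   ≡⟨ -‿inverseʳ (f y) ⟩
          0#            ∎)
        where open ≡-Reasoning

-- Part (b)

module Quartic {F : Field} {q : ℕ} (pp : IsPrimePower q) (size : Size {Field.Carrier F} _≡_ (q ℕ.^ 4)) where

  open Extension {F} {q} {2} {1} pp (s≤s (s≤s z≤n)) size

  -- Multiplication by such an element leads from z to a second point μz whose ratio to z is in
  -- F_(q^2) but not in F_q.
  element-of-Sub-Q∖Sub-q : ∃ λ (μ : Sub Q) → ¬ InSub q (proj₁ μ)
  element-of-Sub-Q∖Sub-q with search size-Q (λ μ → ¬? (InSub? q (proj₁ μ))) (λ { refl p → p })
  ... | yes found = found
  ... | no none = contradiction (size-≤ size-Q size-q
      (λ μ → proj₁ μ , decidable-stable (InSub? q (proj₁ μ)) (λ ∉ → none (μ , ∉)))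
      (λ μ ν e → Sub-≡ {Q} (cong proj₁ e)))
    (ℕₚ.<⇒≱ q<Q)

  Q<q⁴ : Q < q ℕ.^ 4
  Q<q⁴ = ℕₚ.^-monoʳ-< q 1<q {2} {4} (s≤s (s≤s (s≤s z≤n)))

  -- The subfield has q^2 of the q^4 elements. An element outside it provides the second
  -- interpolation point of the converse.
  element∉Sub-Q : ∃ λ u → ¬ InSub Q u
  element∉Sub-Q with search size (λ u → ¬? (InSub? Q u)) (λ { refl p → p })
  ... | yes found = found
  ... | no none = contradiction (size-≤ size size-Q
      (λ u → u , decidable-stable (InSub? Q u) (λ ∉ → none (u , ∉)))
      (λ u v e → cong proj₁ e))
    (ℕₚ.<⇒≱ Q<q⁴)

  module QuarticCodes {m} (a : Fin m → Carrier) where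

    f : Carrier → Carrier
    f = qpoly q a

    open Dimension Carrier
    open Rank F-space size

    Code : V → Set
    Code = C4 q a

    member : Carrier × Carrier × Carrier → V
    member (α , β , γ) x = α * f x + β * x + γ * x ^ Q

    member∈ : ∀ p → Code (member p)
    member∈ (α , β , γ) = α , β , γ , λ x → refl

    onto : ∀ φ → Code φ → ∃ λ p → φ ≈ member p
    onto φ (α , β , γ , e) = (α , β , γ) , e

    Code-subspace : Subspace Code
    Code-subspace = record
      { zero∈ = 0# , 0# , 0# , λ x → sym (solve 3 (λ u v w → con 0 :* u :+ con 0 :* v :+ con 0 :* w := con 0) refl (f x) x (x ^ Q))
      ; comb∈ = λ (c , _) (α , β , γ , e) (α′ , β′ , γ′ , e′) → c * α + α′ , c * β + β′ , c * γ + γ′ , λ x →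
          trans (cong₂ (λ u v → c * u + v) (e x) (e′ x))
            (solve 10 (λ c α β γ α′ β′ γ′ u v w →
                c :* (α :* u :+ β :* v :+ γ :* w) :+ (α′ :* u :+ β′ :* v :+ γ′ :* w)
                := (c :* α :+ α′) :* u :+ (c :* β :+ β′) :* v :+ (c :* γ :+ γ′) :* w)
              refl c α β γ α′ β′ γ′ (f x) x (x ^ Q))
      }

    Code-linear : ∀ {φ} → Code φ → Linear φ
    Code-linear {φ} (α , β , γ , e) = trans (e 0#) (linear-0 lin)
      , λ c x y → trans (e _) (trans (lin (proj₁ c) x y (proj₂ c)) (sym (cong₂ (λ u v → proj₁ c * u + v) (e x) (e y))))
      where
      lin : Fq-linear (member (α , β , γ))
      lin = +-linear (+-linear (scale-linear α (qpoly-linear a)) (scale-linear β (λ c x y c∈ → refl)))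
        (scale-linear γ (^q^-linear 2))

    member-difference : ∀ p p′ → member p ≈ member p′ →
      member (proj₁ p + - proj₁ p′ , proj₁ (proj₂ p) + - proj₁ (proj₂ p′) , proj₂ (proj₂ p) + - proj₂ (proj₂ p′)) ≈ (λ _ → 0#)
    member-difference (α , β , γ) (α′ , β′ , γ′) e x = +-cancelʳ (member (α′ , β′ , γ′) x) _ _ (begin
      A * u + B * x + G * w + (α′ * u + β′ * x + γ′ * w)
        ≡⟨ solve 9 (λ A B G α′ β′ γ′ u v w → A :* u :+ B :* v :+ G :* w :+ (α′ :* u :+ β′ :* v :+ γ′ :* w)
             := (A :+ α′) :* u :+ (B :+ β′) :* v :+ (G :+ γ′) :* w) refl A B G α′ β′ γ′ u x w ⟩
      (A + α′) * u + (B + β′) * x + (G + γ′) * w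
        ≡⟨ cong₂ _+_ (cong₂ (λ A B → A * u + B * x) (x-y+y≡x α α′) (x-y+y≡x β β′)) (cong (_* w) (x-y+y≡x γ γ′)) ⟩
      α * u + β * x + γ * w                   ≡⟨ e x ⟩
      member (α′ , β′ , γ′) x                 ≡⟨ sym (+-identityˡ _) ⟩
      0# + member (α′ , β′ , γ′) x            ∎)
      where
      open ≡-Reasoning
      u = f x
      w = x ^ Q
      A = α + - α′
      B = β + - β′
      G = γ + - γ′

    -- A member with α = 0 is linear over the subfield of order Q.
    ratio₀ : ∀ {β γ} → ¬ (β ≡ 0# × γ ≡ 0#) → ∀ x y → member (0# , β , γ) x ≡ 0# → member (0# , β , γ) y ≡ 0# →
             ¬ x ≡ 0# → ¬ y ≡ 0# → InSub Q (x * y ⁻¹)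
    ratio₀ {β} {γ} nz x y ex ey x≢0 y≢0 with γ ≟ 0#
    ... | yes refl = contradiction (*-cancelʳ x≢0 (trans
        (trans (solve 4 (λ β u x w → β :* x := con 0 :* u :+ β :* x :+ con 0 :* w) refl β (f x) x (x ^ Q)) ex) (sym (zeroˡ x))))
        (λ β≡0 → nz (β≡0 , refl))
    -- What is wanted is v^Q * y = x for v = x / y. Multiplied by γ y^Q it becomes γ x^Q y = γ y^Q
    -- x, and `cross` obtains this by eliminating β from the two kernel equations.
    ... | no γ≢0 = sym (/-unique y≢0 (*-cancelˡ γ≢0 (*-cancelʳ y^Q≢0 (begin
        γ * (v ^ Q * y) * y ^ Q      ≡⟨ solve 4 (λ γ v y w → γ :* (v :* y) :* w := γ :* (v :* w) :* y) refl γ (v ^ Q) y (y ^ Q) ⟩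
        γ * (v ^ Q * y ^ Q) * y      ≡⟨ cong (λ z → γ * z * y) (trans (sym (^-distrib-* v y Q)) (cong (_^ Q) (x*y⁻¹*y≡x x y≢0))) ⟩
        γ * x ^ Q * y                ≡⟨ cross ⟩
        γ * y ^ Q * x                ≡⟨ solve 3 (λ γ w x → γ :* w :* x := γ :* x :* w) refl γ (y ^ Q) x ⟩
        γ * x * y ^ Q                ∎))))
      where
      open ≡-Reasoning
      v = x * y ⁻¹
      y^Q≢0 : ¬ y ^ Q ≡ 0#
      y^Q≢0 e = y≢0 (x^n≡0⇒x≡0 (_≟ 0#) y Q e)
      cross : γ * x ^ Q * y ≡ γ * y ^ Q * x
      cross = +-cancelʳ (β * x * y) _ _ (begin
        γ * x ^ Q * y + β * x * y
          ≡⟨ solve 5 (λ γ w y β x → γ :* w :* y :+ β :* x :* y := (β :* x :+ γ :* w) :* y) refl γ (x ^ Q) y β x ⟩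
        (β * x + γ * x ^ Q) * y     ≡⟨ trans (cong (_* y) (drop x ex)) (zeroˡ y) ⟩
        0#                          ≡⟨ sym (trans (cong (_* x) (drop y ey)) (zeroˡ x)) ⟩
        (β * y + γ * y ^ Q) * x
          ≡⟨ solve 5 (λ γ w y β x → (β :* y :+ γ :* w) :* x := γ :* w :* x :+ β :* x :* y) refl γ (y ^ Q) y β x ⟩
        γ * y ^ Q * x + β * x * y   ∎)
        where
        drop : ∀ x → member (0# , β , γ) x ≡ 0# → β * x + γ * x ^ Q ≡ 0#
        drop x e = trans (solve 5 (λ β x γ w u → β :* x :+ γ :* w := con 0 :* u :+ β :* x :+ γ :* w) refl β x γ (x ^ Q)  (f x)) e

    module Scattered⇒MRD (ps : PartiallyScattered q 2 a) where

      private
        μ : Carrier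
        μ = proj₁ (proj₁ element-of-Sub-Q∖Sub-q)

        μ∈Q : InSub Q μ
        μ∈Q = proj₂ (proj₁ element-of-Sub-Q∖Sub-q)

        μ∉q : ¬ InSub q μ
        μ∉q = proj₂ element-of-Sub-Q∖Sub-q

      -- β x + γ x^Q is multiplied by μ when x is, so f(x)/x would agree at z and at μ z.
      no-line-in-kernel : ∀ {α β γ} → ¬ α ≡ 0# → ∀ z → ¬ z ≡ 0# → member (α , β , γ) z ≡ 0# → ¬ member (α , β , γ) (μ * z) ≡ 0#
      no-line-in-kernel {α} {β} {γ} α≢0 z z≢0 ez eμz = μ∉q (subst (InSub q) μ-ratio
          (ps (μ * z) z μz≢0 z≢0 (cross-multiply μz≢0 z≢0 (trans (cong (_* z) f-μ)
             (solve 3 (λ μ u z → μ :* u :* z := u :* (μ :* z)) refl μ (f z) z)))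
            (subst (InSub Q) (sym μ-ratio) μ∈Q)))
        where
        open ≡-Reasoning
        μ≢0 : ¬ μ ≡ 0#
        μ≢0 e = μ∉q (subst (InSub q) (sym e) (0^ q 0<q))
        μz≢0 : ¬ μ * z ≡ 0#
        μz≢0 = x*y≢0 μ≢0 z≢0
        μ-ratio : μ * z * z ⁻¹ ≡ μ
        μ-ratio = /-unique z≢0 refl
        f-μ : f (μ * z) ≡ μ * f z
        f-μ = *-cancelˡ α≢0 (+-cancelʳ (μ * (β * z + γ * z ^ Q)) _ _ (begin
          α * f (μ * z) + μ * (β * z + γ * z ^ Q)
            ≡⟨ solve 6 (λ αu μ β z γ w → αu :+ μ :* (β :* z :+ γ :* w) := αu :+ β :* (μ :* z) :+ γ :* (μ :* w)) refl
                 (α * f (μ * z)) μ β z γ (z ^ Q) ⟩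
          α * f (μ * z) + β * (μ * z) + γ * (μ * z ^ Q)
            ≡⟨ cong (λ w → α * f (μ * z) + β * (μ * z) + γ * w)
                 (sym (trans (^-distrib-* μ z Q) (cong (_* z ^ Q) μ∈Q))) ⟩
          member (α , β , γ) (μ * z)         ≡⟨ eμz ⟩
          0#                                 ≡⟨ sym (trans (cong (μ *_) ez) (zeroʳ μ)) ⟩
          μ * member (α , β , γ) z
            ≡⟨ solve 7 (λ α u μ β z γ w → μ :* (α :* u :+ β :* z :+ γ :* w) := α :* (μ :* u) :+ μ :* (β :* z :+ γ :* w)) refl
                 α (f z) μ β z γ (z ^ Q) ⟩
          α * (μ * f z) + μ * (β * z + γ * z ^ Q)   ∎))

      module R₀ {β γ} (nz : ¬ (β ≡ 0# × γ ≡ 0#)) =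
        RatioEmbedding size (λ x → x) (λ e → e) 0<Q (member (0# , β , γ)) (ratio₀ nz)

      -- A zero map vanishes at both 1 and μ, which is excluded when α ≠ 0; when α = 0 its kernel
      -- would exceed the bound `Q`.
      member≢0 : ∀ {α β γ} → ¬ (α ≡ 0# × β ≡ 0# × γ ≡ 0#) → ¬ (∀ x → member (α , β , γ) x ≡ 0#)
      member≢0 {α} {β} {γ} nz φ≡0 = by-α (α ≟ 0#)
        where
        by-α : Dec (α ≡ 0#) → ⊥
        by-α (no α≢0)   = no-line-in-kernel α≢0 1# (λ e → 0≢1 (sym e)) (φ≡0 _) (φ≡0 _)
        by-α (yes refl) = R₀.nonzero (λ (u , v) → nz (refl , u , v)) size-Q Q<q⁴ φ≡0

      rank≥2 : ∀ {α β γ φ r} → ¬ (α ≡ 0# × β ≡ 0# × γ ≡ 0#) → Code φ → φ ≈ member (α , β , γ) → HasRank q φ r → 2 ≤ r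
      rank≥2 {α} {β} {γ} {φ} {r} nz φ∈ e rank = by-α (α ≟ 0#)
        where
        φ0≡0 = proj₁ (Code-linear φ∈)
        lin  = proj₂ (Code-linear φ∈)
        -1q : Sub q
        -1q = - 1# , -∈Sub 0<q frobenius-q (1^ q)
        q^r*Q : q ℕ.^ r ℕ.* Q ≡ q ℕ.^ (r ℕ.+ 2)
        q^r*Q = sym (ℕₚ.^-distribˡ-+-* q r 2)
        val : Carrier → Fin (q ℕ.^ r)
        val = value (Code-linear φ∈) rank
        φ-difference : ∀ x y → val x ≡ val y → φ (- 1# * y + x) ≡ 0#
        φ-difference x y e = trans (lin -1q y x) (trans
          (cong₂ _+_ (-1*x≈-x (φ y)) (value-injective (Code-linear φ∈) rank e)) (-‿inverseˡ (φ y)))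
        doubled : (∃ λ z → ¬ z ≡ 0# × φ z ≡ 0# × φ (μ * z) ≡ 0#) ⊎ (4 ≤ r ℕ.+ r)
        -- Without such a z, the map z ↦ (φ(z), φ(μz)) is injective, since the difference of two
        -- points with equal values would be one. Hence q^4 is at most q^r * q^r.
        doubled = [ inj₁ , (λ none → inj₂ (^-cancelʳ-≤ 1<q (subst (q ℕ.^ 4 ≤_) (sym (ℕₚ.^-distribˡ-+-* q r r))
          (size-≤ size (size-× (size-Fin _) (size-Fin _)) (λ z → val z , val (μ * z)) (λ x y e′ →
             sym (x-y≡0⇒x≡y y x (y-x≡0 none x y (cong proj₁ e′) (cong proj₂ e′)))))))) ]′ kernel-line
          where
          P : Carrier → Set
          P z = ¬ z ≡ 0# × φ z ≡ 0# × φ (μ * z) ≡ 0#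
          kernel-line : ∃ P ⊎ ¬ ∃ P
          kernel-line = toSum (search size {P} (λ z → ¬? (z ≟ 0#) ×-dec ((φ z ≟ 0#) ×-dec (φ (μ * z) ≟ 0#))) (λ { refl p → p }))
          y-x≡0 : ¬ ∃ P → ∀ x y → val x ≡ val y → val (μ * x) ≡ val (μ * y) → y + - x ≡ 0#
          y-x≡0 none x y e₁ e₂ = trans (trans (+-comm y (- x)) (cong (_+ y) (sym (-1*x≈-x x)))) w≡0
            where
            w : Carrier
            w = - 1# * x + y
            w≡0 : w ≡ 0#
            w≡0 = decidable-stable (w ≟ 0#) λ w≢0 → none (w , w≢0 , φ-difference y x (sym e₁) ,
              trans (cong φ (solve 4 (λ μ n x y → μ :* (n :* x :+ y) := n :* (μ :* x) :+ μ :* y) refl μ (- 1#) x y))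
                    (φ-difference (μ * y) (μ * x) (sym e₂)))
        by-α : Dec (α ≡ 0#) → 2 ≤ r
        by-α (no α≢0) = [ (λ (z , z≢0 , ez , eμz) → contradiction (trans (sym (e _)) eμz)
                                (no-line-in-kernel α≢0 z z≢0 (trans (sym (e _)) ez)))
                        , half ]′ doubled
          where
          half : 4 ≤ r ℕ.+ r → 2 ≤ r
          half le = ℕₚ.≮⇒≥ (λ { (s≤s r≤1) → contradiction (ℕₚ.≤-trans le (ℕₚ.+-mono-≤ r≤1 r≤1)) (λ { (s≤s (s≤s ())) }) })
        -- For α = 0 the kernel has at most q^2 elements, so q^4 is at most q^r * q^2.
        by-α (yes refl) = ℕₚ.+-cancelʳ-≤ 2 2 r (^-cancelʳ-≤ 1<q (subst (q ℕ.^ 4 ≤_) q^r*Q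
            (kernel-embeds⇒ (Code-linear φ∈) rank size-Q
              (λ x p → proj₁ (R₀.kernel-embedding nz₀) x (trans (sym (e x)) p))
              (λ x y p p′ → proj₂ (R₀.kernel-embedding nz₀) x y (trans (sym (e x)) p) (trans (sym (e y)) p′)))))
          where
          nz₀ : ¬ (β ≡ 0# × γ ≡ 0#)
          nz₀ (u , v) = nz (refl , u , v)

      minimum : ∀ φ → Code φ → ¬ (∀ x → φ x ≡ 0#) → ∃ λ r → HasRank q φ r × 2 ≤ r
      minimum φ φ∈ φ≢0 = bound (onto φ φ∈) (hasRank (Code-linear φ∈))
        where
        bound : (∃ λ p → φ ≈ member p) → (∃ λ r → HasRank q φ r) → ∃ λ r → HasRank q φ r × 2 ≤ r
        bound ((α , β , γ) , e) (r , rank) = r , rank , rank≥2 nz φ∈ e rank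
          where
          nz : ¬ (α ≡ 0# × β ≡ 0# × γ ≡ 0#)
          nz (α≡0 , β≡0 , γ≡0) = φ≢0 (λ x → trans (e x) (trans
            (cong₂ _+_ (cong₂ (λ u v → u * f x + v * x) α≡0 β≡0) (cong (_* x ^ Q) γ≡0))
            (solve 3 (λ u v w → con 0 :* u :+ con 0 :* v :+ con 0 :* w := con 0) refl (f x) x (x ^ Q))))

      -- The map x^Q - x vanishes on the q^2 elements of `Sub Q`, so its rank is at most 2.
      attained : ∃ λ φ → Code φ × ¬ (∀ x → φ x ≡ 0#) × HasRank q φ 2
      attained = φ , φ∈ , member≢0 nz , subst (HasRank q φ) (ℕₚ.≤-antisym r≤2 (rank≥2 nz φ∈ (λ _ → refl) rank)) rank
        where
        φ  = member (0# , - 1# , 1#)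
        φ∈ = member∈ (0# , - 1# , 1#)
        nz : ¬ (0# ≡ 0# × - 1# ≡ 0# × 1# ≡ 0#)
        nz (_ , _ , 1≡0) = 0≢1 (sym 1≡0)
        r    = proj₁ (hasRank (Code-linear φ∈))
        rank = proj₂ (hasRank (Code-linear φ∈))
        φ≡0 : (x : Sub Q) → φ (proj₁ x) ≡ 0#
        φ≡0 (x , x∈) = begin
          0# * f x + - 1# * x + 1# * x ^ Q
            ≡⟨ solve 4 (λ u n x w → con 0 :* u :+ n :* x :+ con 1 :* w := n :* x :+ w) refl (f x) (- 1#) x (x ^ Q) ⟩
          - 1# * x + x ^ Q     ≡⟨ cong₂ _+_ (-1*x≈-x x) x∈ ⟩
          - x + x              ≡⟨ -‿inverseˡ x ⟩
          0#                   ∎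
          where open ≡-Reasoning
        r≤2 : r ≤ 2
        r≤2 = ℕₚ.+-cancelʳ-≤ 2 r 2 (^-cancelʳ-≤ 1<q (subst (_≤ q ℕ.^ 4) (sym (ℕₚ.^-distribˡ-+-* q r 2))
          (embeds-in-kernel⇒ (Code-linear φ∈) rank size-Q proj₁ φ≡0 (λ _ _ → Sub-≡ {Q}))))

      -- The bound is 4 (4 - 2 + 1) = 12, and three coefficients with q^4 values each give q^12
      -- maps, distinct because no nonzero triple yields the zero map.
      dimension : HasDim Code 12
      dimension = Parametrised.hasDim-injective size size³ Code-subspace member member∈ onto 12
        (sym (trans (ℕₚ.^-distribˡ-+-* q 4 8) (cong (q ℕ.^ 4 ℕ.*_) (ℕₚ.^-distribˡ-+-* q 4 4))))
        (λ p p′ e → decidable-stable (decide size³ p p′) λ ne →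
          member≢0 (λ (u , v , w) → ne (cong₂ _,_ (x-y≡0⇒x≡y _ _ u) (cong₂ _,_ (x-y≡0⇒x≡y _ _ v) (x-y≡0⇒x≡y _ _ w))))
            (member-difference p p′ e))
        where
        size³ = size-× size (size-× size size)

      isMRD : IsMRD q 4 4 2 Code
      isMRD = (minimum , attained) , dimension

    module MRD⇒Scattered (mrd : IsMRD q 4 4 2 Code) where

      -- If f(x) = b x + c x^Q, two coefficients suffice to list the code, leaving at most q^8
      -- members instead of q^12.
      member-zero⇒⊥ : ∀ {b c} → ¬ (∀ x → member (1# , - b , - c) x ≡ 0#)
      member-zero⇒⊥ {b} {c} φ≡0 = contradiction
        (^-cancelʳ-≤ 1<q {12} {8} (subst (q ℕ.^ 12 ≤_) (sym (ℕₚ.^-distribˡ-+-* q 4 4))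
          (Parametrised.hasDim⇒≤ size (size-× size size) Code-subspace
            (λ (β , γ) x → β * x + γ * x ^ Q)
            (λ (β , γ) → 0# , β , γ , λ x →
              solve 5 (λ u β x γ w → β :* x :+ γ :* w := con 0 :* u :+ β :* x :+ γ :* w) refl (f x) β x γ (x ^ Q))
            (λ φ φ∈ → collapse φ (onto φ φ∈))
            (proj₂ mrd))))
        (ℕₚ.<⇒≱ (ℕₚ.m≤m+n 9 3))
        where
        open ≡-Reasoning
        f-value : ∀ x → f x ≡ b * x + c * x ^ Q
        f-value x = +-cancelʳ (- b * x + - c * x ^ Q) _ _ (begin
          f x + (- b * x + - c * x ^ Q)
            ≡⟨ solve 5 (λ u m x n w → u :+ (m :* x :+ n :* w) := con 1 :* u :+ m :* x :+ n :* w) refl (f x) (- b) x (- c) (x ^ Q) ⟩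
          member (1# , - b , - c) x       ≡⟨ φ≡0 x ⟩
          0#
            ≡⟨ solve 2 (λ x w → con 0 := con 0 :* x :+ con 0 :* w) refl x (x ^ Q) ⟩
          0# * x + 0# * x ^ Q
            ≡⟨ cong₂ (λ u v → u * x + v * x ^ Q) (sym (-‿inverseʳ b)) (sym (-‿inverseʳ c)) ⟩
          (b + - b) * x + (c + - c) * x ^ Q
            ≡⟨ solve 6 (λ b m c n x w → (b :+ m) :* x :+ (c :+ n) :* w := b :* x :+ c :* w :+ (m :* x :+ n :* w)) refl
                 b (- b) c (- c) x (x ^ Q) ⟩
          b * x + c * x ^ Q + (- b * x + - c * x ^ Q)   ∎)
        collapse : ∀ φ → (∃ λ p → φ ≈ member p) → ∃ λ p → φ ≈ (λ x → proj₁ p * x + proj₂ p * x ^ Q)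
        collapse φ ((α , β , γ) , e) = (α * b + β , α * c + γ) , λ x → trans (e x)
          (trans (cong (λ z → α * z + β * x + γ * x ^ Q) (f-value x))
            (solve 7 (λ α b c β γ x w → α :* (b :* x :+ c :* w) :+ β :* x :+ γ :* w
               := (α :* b :+ β) :* x :+ (α :* c :+ γ) :* w) refl α b c β γ x (x ^ Q)))

      member-from-value : ∀ {b c} x → f x ≡ b * x + c * x ^ Q → member (1# , - b , - c) x ≡ 0#
      member-from-value {b} {c} x e = begin
        1# * f x + - b * x + - c * x ^ Q
          ≡⟨ cong (λ u → 1# * u + - b * x + - c * x ^ Q) e ⟩
        1# * (b * x + c * x ^ Q) + - b * x + - c * x ^ Q
          ≡⟨ solve 6 (λ b m c n x w → con 1 :* (b :* x :+ c :* w) :+ m :* x :+ n :* w := (b :+ m) :* x :+ (c :+ n) :* w) refl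
               b (- b) c (- c) x (x ^ Q) ⟩
        (b + - b) * x + (c + - c) * x ^ Q
          ≡⟨ cong₂ (λ u v → u * x + v * x ^ Q) (-‿inverseʳ b) (-‿inverseʳ c) ⟩
        0# * x + 0# * x ^ Q
          ≡⟨ solve 2 (λ x w → con 0 :* x :+ con 0 :* w := con 0) refl x (x ^ Q) ⟩
        0#   ∎
        where open ≡-Reasoning

      -- Interpolating f by b x + c x^Q at z and at u z, with u outside the subfield of order Q, gives
      -- a member of the code that vanishes on the span of z, μ z and u z.
      module Interpolation (z μ : Carrier) (z≢0 : ¬ z ≡ 0#) (μ∈Q : InSub Q μ) (μ∉q : ¬ InSub q μ) (f-μ : f (μ * z) ≡ μ * f z) where

        open ≡-Reasoning
        open Space F-space

        u : Carrier
        u = proj₁ element∉Sub-Q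

        u∉Q : ¬ InSub Q u
        u∉Q = proj₂ element∉Sub-Q

        -- Subtracting u times the condition at z from the condition at u z eliminates b and leaves
        -- c δ = f(u z) - u f(z). It is solvable because u^Q differs from u.
        δ : Carrier
        δ = z ^ Q * (u ^ Q + - u)

        δ≢0 : ¬ δ ≡ 0#
        δ≢0 = x*y≢0 (λ e → z≢0 (x^n≡0⇒x≡0 (_≟ 0#) z Q e)) (λ e → u∉Q (x-y≡0⇒x≡y _ _ e))

        c b : Carrier
        c = (f (u * z) + - (u * f z)) * δ ⁻¹
        b = (f z + - (c * z ^ Q)) * z ⁻¹

        value-z : f z ≡ b * z + c * z ^ Q
        value-z = sym (trans (cong (_+ c * z ^ Q) (x*y⁻¹*y≡x _ z≢0)) (x-y+y≡x (f z) (c * z ^ Q)))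

        value-uz : f (u * z) ≡ b * (u * z) + c * (u * z) ^ Q
        value-uz = sym (begin
          b * (u * z) + c * (u * z) ^ Q
            ≡⟨ cong (λ w → b * (u * z) + c * w) (^-distrib-* u z Q) ⟩
          b * (u * z) + c * (u ^ Q * z ^ Q)
            ≡⟨ cong (λ w → b * (u * z) + c * (w * z ^ Q)) (sym (x-y+y≡x (u ^ Q) u)) ⟩
          b * (u * z) + c * ((u ^ Q + - u + u) * z ^ Q)
            ≡⟨ solve 6 (λ b u z c d w → b :* (u :* z) :+ c :* ((d :+ u) :* w) := c :* (w :* d) :+ u :* (b :* z :+ c :* w)) refl
                 b u z c (u ^ Q + - u) (z ^ Q) ⟩
          c * δ + u * (b * z + c * z ^ Q)
            ≡⟨ cong₂ _+_ (x*y⁻¹*y≡x _ δ≢0) (cong (u *_) (sym value-z)) ⟩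
          f (u * z) + - (u * f z) + u * f z
            ≡⟨ x-y+y≡x (f (u * z)) (u * f z) ⟩
          f (u * z)   ∎)

        -- No third condition is imposed: b x + c x^Q commutes with multiplication by μ in `Sub Q`,
        -- and `f-μ` says that f does so at z.
        value-μz : f (μ * z) ≡ b * (μ * z) + c * (μ * z) ^ Q
        value-μz = begin
          f (μ * z)                            ≡⟨ f-μ ⟩
          μ * f z                              ≡⟨ cong (μ *_) value-z ⟩
          μ * (b * z + c * z ^ Q)
            ≡⟨ solve 5 (λ μ b z c w → μ :* (b :* z :+ c :* w) := b :* (μ :* z) :+ c :* (μ :* w)) refl μ b z c (z ^ Q) ⟩
          b * (μ * z) + c * (μ * z ^ Q)
            ≡⟨ cong (λ w → b * (μ * z) + c * w) (sym (trans (^-distrib-* μ z Q) (cong (_* z ^ Q) μ∈Q))) ⟩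
          b * (μ * z) + c * (μ * z) ^ Q        ∎

        φ : V
        φ = member (1# , - b , - c)

        φ∈ : Code φ
        φ∈ = member∈ (1# , - b , - c)

        span : Sub q × Sub q × Sub q → Carrier
        span (c₁ , c₂ , c₃) = comb c₁ z (comb c₂ (μ * z) (comb c₃ (u * z) 0D))

        span∈ker : ∀ p → φ (span p) ≡ 0#
        span∈ker (c₁ , c₂ , c₃) = begin
          φ (span (c₁ , c₂ , c₃))
            ≡⟨ trans (lin c₁ z _) (cong (proj₁ c₁ * φ z +_)
                 (trans (lin c₂ (μ * z) _) (cong (proj₁ c₂ * φ (μ * z) +_) (lin c₃ (u * z) 0D)))) ⟩
          proj₁ c₁ * φ z + (proj₁ c₂ * φ (μ * z) + (proj₁ c₃ * φ (u * z) + φ 0D))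
            ≡⟨ cong₂ (λ v w → proj₁ c₁ * v + w) (member-from-value z value-z)
                 (cong₂ (λ v w → proj₁ c₂ * v + w) (member-from-value (μ * z) value-μz)
                   (cong₂ (λ v w → proj₁ c₃ * v + w) (member-from-value (u * z) value-uz) (proj₁ (Code-linear φ∈)))) ⟩
          proj₁ c₁ * 0# + (proj₁ c₂ * 0# + (proj₁ c₃ * 0# + 0#))
            ≡⟨ solve 3 (λ x y w → x :* con 0 :+ (y :* con 0 :+ (w :* con 0 :+ con 0)) := con 0) refl _ _ _ ⟩
          0#   ∎
          where lin = proj₂ (Code-linear φ∈)

        span-shape : ∀ p → span p ≡ (proj₁ (proj₁ p) + proj₁ (proj₁ (proj₂ p)) * μ + proj₁ (proj₂ (proj₂ p)) * u) * z
        span-shape ((c₁ , _) , (c₂ , _) , (c₃ , _)) =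
          solve 6 (λ x y w z μ u → x :* z :+ (y :* (μ :* z) :+ (w :* (u :* z) :+ con 0)) := (x :+ y :* μ :+ w :* u) :* z)
            refl c₁ c₂ c₃ z μ u

        -- Independence is applied twice: over the field of order `Q`, which contains c₁ + c₂ μ but
        -- not u, and then over the field of order q, which does not contain μ.
        span-injective : ∀ p p′ → span p ≡ span p′ → p ≡ p′
        span-injective p@((c₁ , c₁∈) , (c₂ , c₂∈) , (c₃ , c₃∈)) p′@((d₁ , d₁∈) , (d₂ , d₂∈) , (d₃ , d₃∈)) e =
          cong₂ _,_ (Sub-≡ {q} (proj₁ inner)) (cong₂ _,_ (Sub-≡ {q} (proj₂ inner)) (Sub-≡ {q} (proj₂ outer)))
          where
          A∈ : ∀ {x y} → InSub q x → InSub q y → InSub Q (x + y * μ)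
          A∈ x∈ y∈ = +∈Sub 0<Q frobenius-Q (InSub-^ {q} 2 x∈) (*∈Sub 0<Q frobenius-Q (InSub-^ {q} 2 y∈) μ∈Q)
          outer : c₁ + c₂ * μ ≡ d₁ + d₂ * μ × c₃ ≡ d₃
          outer = independent 0<Q frobenius-Q u∉Q (A∈ c₁∈ c₂∈) (InSub-^ {q} 2 c₃∈) (A∈ d₁∈ d₂∈) (InSub-^ {q} 2 d₃∈)
            (*-cancelʳ z≢0 (trans (sym (span-shape p)) (trans e (span-shape p′))))
          inner : c₁ ≡ d₁ × c₂ ≡ d₂
          inner = independent 0<q frobenius-q μ∉q c₁∈ c₂∈ d₁∈ d₂∈ (proj₁ outer)

        -- The kernel contains q^3 elements, so r + 3 ≤ 4, whereas the minimum distance demands r ≥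
        -- 2.
        absurd : ⊥
        absurd = rank-bound (proj₁ (proj₁ mrd) φ φ∈ member-zero⇒⊥)
          where
          rank-bound : (∃ λ r → HasRank q φ r × 2 ≤ r) → ⊥
          rank-bound (r , rank , 2≤r) = contradiction (ℕₚ.≤-trans (ℕₚ.+-monoˡ-≤ 3 2≤r) r+3≤4) (ℕₚ.<⇒≱ ℕₚ.≤-refl)
            where
            q³ : q ℕ.* (q ℕ.* q) ≡ q ℕ.^ 3
            q³ = cong (λ w → q ℕ.* (q ℕ.* w)) (sym (ℕₚ.*-identityʳ q))
            r+3≤4 : r ℕ.+ 3 ≤ 4
            r+3≤4 = ^-cancelʳ-≤ 1<q (subst (_≤ q ℕ.^ 4) (trans (cong (q ℕ.^ r ℕ.*_) q³) (sym (ℕₚ.^-distribˡ-+-* q r 3)))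
              (embeds-in-kernel⇒ (Code-linear φ∈) rank (size-× size-q (size-× size-q size-q)) span span∈ker span-injective))

      scattered : PartiallyScattered q 2 a
      scattered y z y≢0 z≢0 e μ∈ = decidable-stable (InSub? q (y * z ⁻¹)) λ μ∉ →
        -- With μ = y / z, the equality of f(y)/y and f(z)/z reads f(μz) = μ f(z).
        Interpolation.absurd z (y * z ⁻¹) z≢0 μ∈ μ∉ (begin
          f (y * z ⁻¹ * z)   ≡⟨ cong f (x*y⁻¹*y≡x y z≢0) ⟩
          f y                ≡⟨ sym (x*y⁻¹*y≡x (f y) y≢0) ⟩
          f y * y ⁻¹ * y     ≡⟨ cong (_* y) e ⟩
          f z * z ⁻¹ * y     ≡⟨ solve 3 (λ a y i → a :* i :* y := y :* i :* a) refl (f z) y (z ⁻¹) ⟩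
          y * z ⁻¹ * f z     ∎)
        where open ≡-Reasoning

    scattered⇔MRD : PartiallyScattered q 2 a ⇔ IsMRD q 4 4 2 (C4 q a)
    scattered⇔MRD = mk⇔ Scattered⇒MRD.isMRD MRD⇒Scattered.scattered

open import Data.Nat using (_*_; _^_; _∸_)

theorem3p3 : ((q t t' : ℕ) → IsPrimePower q → 2 ≤ t → 2 ≤ t' →
    (F : Field) → (Fin (q ^ (t * t')) ↔ Field.Carrier F) →
    (a : Fin (t * t') → Field.Carrier F) → (k : ℕ) →
    (FF.PartiallyScattered F q t a
    ⇔ ((σ : Field.Carrier F) → ¬ (σ ≡ Field.0# F) →
    FF.IsMRD F q (t * t') t (t ∸ 1) (FF.Cfσk F q t a σ k))))
    ×
    ((q : ℕ) → IsPrimePower q →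
    (F : Field) → (Fin (q ^ 4) ↔ Field.Carrier F) →
    (a : Fin 4 → Field.Carrier F) →
    (FF.PartiallyScattered F q 2 a ⇔ FF.IsMRD F q 4 4 2 (FF.C4 F q a)))
theorem3p3 =
  (λ { q t (suc s) pp 1<t _ F bij a k → Extension.RestrictedCodes.scattered⇔MRD pp 1<t (↔⇒size bij) a k }) ,
  (λ q pp F bij a → Quartic.QuarticCodes.scattered⇔MRD pp (↔⇒size bij) a)
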